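{- Let $q$ be a prime power, $n$ a positive integer, let $\mathcal{F}\subseteq\{1,\ldots,n\}\times\{1,\ldots,n\}$ be a symmetric Ferrers diagram, and let $r\in\mathbb{Z}$. Then $$W_r(\mathrm{Sym}_q^{n\times n}[\mathcal{F}])=\sum_{\substack{t,s\ge0\\2t+s=r}}(q-1)^{t+s}\,q^{(|\mathcal{F}|-t-s)/2}\,R^{\mathrm{sym}}_{t,s}(\mathcal{F};q^{ -1/2}).$$
   Context: A Ferrers diagram is a finite set $\mathcal{F}\subseteq\mathbb{N}\times\mathbb{N}$ ($\mathbb{N}$ the positive integers; $(i,j)$ = row $i$, column $j$) such that $(i,j)\in\mathcal{F}$ implies $(s,t)\in\mathcal{F}$ for all $1\le s\le i$, $1\le t\le j$; it is symmetric if $(i,j)\in\mathcal{F}$ implies $(j,i)\in\mathcal{F}$. A placement of non-attacking rooks is a set of cells no two sharing a row or column index; $\mathrm{NAR}(\mathcal{F},r)$ is the set of such placements $P\subseteq\mathcal{F}$ with $|P|=r$. For $P$, $\mathrm{ATK}(P)=\bigcup_{(a,b)\in P}\big(\{(s,b):1\le s\le a\}\cup\{(a,t):1\le t\le b\}\big)$ and $\mathrm{inv}(\mathcal{F},P)=|\mathcal{F}\setminus\mathrm{ATK}(P)|$. Let $\Xi=\{(i,i):i\in\mathbb{N}\}$. Define $\mathrm{NAR}^{\mathrm{alt}}(\mathcal{F},r)=\{P\in\mathrm{NAR}(\mathcal{F},r): (i,j)\in P\Rightarrow i\ne j\text{ and }(j,i)\in P\}$ and, for $t,s\in\mathbb{N}_0$,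 $\mathrm{NAR}^{\mathrm{sym}}(\mathcal{F},t,s)$ as the set of $P\in\mathrm{NAR}(\mathcal{F},2t+s)$ of the form $P=T\cup S$ with $T\in\mathrm{NAR}^{\mathrm{alt}}(\mathcal{F},2t)$, $S\subseteq\Xi$, $|S|=s$. The symmetric $(t,s)$-th $q$-rook polynomial is $R^{\mathrm{sym}}_{t,s}(\mathcal{F};q)=\sum_{P\in\mathrm{NAR}^{\mathrm{sym}}(\mathcal{F},t,s)}q^{\mathrm{inv}(\mathcal{F},P)}$, set to $0$ if $t<0$, $s<0$ or $\mathrm{NAR}^{\mathrm{sym}}(\mathcal{F},t,s)=\emptyset$, and with $R^{\mathrm{sym}}_{0,0}(\mathcal{F};q)=q^{|\mathcal{F}|}$; $R^{\mathrm{sym}}_{t,s}(\mathcal{F};q^{ -1/2})$ denotes its evaluation at $q^{ -1/2}$. $\mathrm{Sym}_q^{n\times n}[\mathcal{F}]$ is the set of symmetric $n\times n$ matrices over $\mathbb{F}_q$ with support contained in $\mathcal{F}$, and $W_r(\mathcal{C})$ is the number of matrices of rank $r$ in $\mathcal{C}$. -}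

module Defs where

open import Level using (0ℓ)
open import Data.Bool using (Bool; true; false; _∧_; _∨_; not; if_then_else_)
open import Data.Nat using (ℕ; zero; suc; _+_; _*_; _∸_; _^_; _≤_; _⊔_; _≡ᵇ_)
open import Data.Nat.Primality using (Prime)
open import Data.Integer using (ℤ; +_; -[1+_]; ∣_∣)
open import Data.Fin using (Fin; _≤?_)
open import Data.Fin.Properties using () renaming (_≟_ to _≟ᶠ_)
open import Data.Maybe using (Maybe; just; nothing)
open import Data.List using (List; []; _∷_; [_]; map; concatMap; filter; length; foldr; allFin; upTo)
open import Data.List.Membership.Propositional using (_∈_)
open import Data.List.Relation.Unary.Unique.Propositional using (Unique)
open import Data.Vec using (Vec; []; _∷_; lookup; toList)
open import Data.Product using (_×_; _,_; ∃; Σ; proj₁; proj₂)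
open import Relation.Nullary using (¬_; does)
open import Relation.Binary.PropositionalEquality using (_≡_)
open import Relation.Binary.Definitions using (DecidableEquality)
open import Algebra.Structures using (IsCommutativeRing)

IsPrimePower : ℕ → Set
IsPrimePower q = ∃ λ p → ∃ λ k → Prime p × (1 ≤ k) × (q ≡ p ^ k)

record FiniteField : Set₁ where
  infixl 6 _+ᶠ_
  infixl 7 _*ᶠ_
  field
    Carrier  : Set
    _+ᶠ_     : Carrier → Carrier → Carrier
    _*ᶠ_     : Carrier → Carrier → Carrier
    -ᶠ_      : Carrier → Carrier
    0#       : Carrier
    1#       : Carrier
    isCommutativeRing : IsCommutativeRing _≡_ _+ᶠ_ _*ᶠ_ -ᶠ_ 0# 1#
    0≢1      : ¬ (0# ≡ 1#)
    inverse  : ∀ x → ¬ (x ≡ 0#) → ∃ λ y → x *ᶠ y ≡ 1#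
    _≟_      : DecidableEquality Carrier
    elements : List Carrier
    complete : ∀ x → x ∈ elements
    unique   : Unique elements

  order : ℕ
  order = length elements

allVecs : {A : Set} → List A → (n : ℕ) → List (Vec A n)
allVecs xs zero    = [ [] ]
allVecs xs (suc n) = concatMap (λ x → map (x ∷_) (allVecs xs n)) xs

allLists : {A : Set} → List A → ℕ → List (List A)
allLists xs zero    = [ [] ]
allLists xs (suc n) = concatMap (λ x → map (x ∷_) (allLists xs n)) xs

all : {A : Set} → (A → Bool) → List A → Bool
all p = foldr (λ x b → p x ∧ b) true

any : {A : Set} → (A → Bool) → List A → Bool
any p = foldr (λ x b → p x ∨ b) false

count : {A : Set} → (A → Bool) → List A → ℕ
count p xs = length (filter (λ x → p x Data.Bool.≟ true) xs)

maximum : List ℕ → ℕ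
maximum = foldr _⊔_ 0

_==ᶠ_ : {n : ℕ} → Fin n → Fin n → Bool
i ==ᶠ j = does (i ≟ᶠ j)

_≤ᵇᶠ_ : {n : ℕ} → Fin n → Fin n → Bool
i ≤ᵇᶠ j = does (i ≤? j)

cells : (n : ℕ) → List (Fin n × Fin n)
cells n = concatMap (λ i → map (λ j → (i , j)) (allFin n)) (allFin n)

-- Diagrams inside {1..n}×{1..n}; row/column index k+1 is  Fin n  value k.

Diagram : ℕ → Set
Diagram n = Fin n → Fin n → Bool

IsFerrers : {n : ℕ} → Diagram n → Set
IsFerrers {n} F = ∀ (i j s t : Fin n) → F i j ≡ true →
  s Data.Fin.≤ i → t Data.Fin.≤ j → F s t ≡ true

IsSymmetricDiagram : {n : ℕ} → Diagram n → Set
IsSymmetricDiagram {n} F = ∀ (i j : Fin n) → F i j ≡ true → F j i ≡ true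

size : {n : ℕ} → Diagram n → ℕ
size {n} F = count (λ c → F (proj₁ c) (proj₂ c)) (cells n)

-- Rook placements in the n×n grid.  A set P of cells with no two in the
-- same row or column is encoded (bijectively) as the vector p with
-- p i = just j iff (i,j) ∈ P, and p i = nothing if row i has no rook,
-- subject to column-injectivity.

Placement : ℕ → Set
Placement n = Vec (Maybe (Fin n)) n

allPlacements : (n : ℕ) → List (Placement n)
allPlacements n = allVecs (nothing ∷ map just (allFin n)) n

rookAt : {n : ℕ} → Placement n → Fin n → Fin n → Bool
rookAt p i j with lookup p i
... | just b  = b ==ᶠ j
... | nothing = false

-- no two rooks share a column (rows are distinct by the encoding)
colInjective : {n : ℕ} → Placement n → Bool
colInjective {n} p = all (λ c → all (λ a →
   not (rookAt p (proj₁ c) (proj₂ c) ∧ rookAt p a (proj₂ c)) ∨ (a ==ᶠ proj₁ c))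
   (allFin n)) (cells n)

inside : {n : ℕ} → Diagram n → Placement n → Bool
inside {n} F p = all (λ c → not (rookAt p (proj₁ c) (proj₂ c)) ∨ F (proj₁ c) (proj₂ c)) (cells n)

offDiagSymmetric : {n : ℕ} → Placement n → Bool
offDiagSymmetric {n} p = all (λ c →
   not (rookAt p (proj₁ c) (proj₂ c)) ∨ (proj₁ c ==ᶠ proj₂ c) ∨ rookAt p (proj₂ c) (proj₁ c))
   (cells n)

numDiag : {n : ℕ} → Placement n → ℕ
numDiag {n} p = count (λ i → rookAt p i i) (allFin n)

numOffDiag : {n : ℕ} → Placement n → ℕ
numOffDiag {n} p = count (λ c → rookAt p (proj₁ c) (proj₂ c) ∧ not (proj₁ c ==ᶠ proj₂ c)) (cells n)

-- P ∈ NAR^sym(F,t,s):  P = T ∪ S, T ∈ NAR^alt(F,2t), S ⊆ Ξ, |S| = s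
isNARsym : {n : ℕ} → Diagram n → ℕ → ℕ → Placement n → Bool
isNARsym F t s p = colInjective p ∧ inside F p ∧ offDiagSymmetric p
  ∧ (numOffDiag p ≡ᵇ (2 * t)) ∧ (numDiag p ≡ᵇ s)

attacked : {n : ℕ} → Placement n → Fin n → Fin n → Bool
attacked {n} p i j = any (λ c →
   rookAt p (proj₁ c) (proj₂ c) ∧
     (((proj₂ c ==ᶠ j) ∧ (i ≤ᵇᶠ proj₁ c)) ∨ ((proj₁ c ==ᶠ i) ∧ (j ≤ᵇᶠ proj₂ c))))
   (cells n)

inv : {n : ℕ} → Diagram n → Placement n → ℕ
inv {n} F p = count (λ c → F (proj₁ c) (proj₂ c) ∧ not (attacked p (proj₁ c) (proj₂ c))) (cells n)

-- The symmetric (t,s)-th q-rook polynomial R^sym_{t,s}(F;x) = Σ_{e ∈ RsymExps} x^e,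
-- represented by the list of exponents inv(F,P), P ∈ NAR^sym(F,t,s).
-- (For t = s = 0 the only placement is P = ∅ with inv = |F|, giving q^{|F|};
--  an empty NAR^sym gives the zero polynomial.)
RsymExps : {n : ℕ} → Diagram n → ℕ → ℕ → List ℕ
RsymExps {n} F t s = map (inv F) (filter (λ p → isNARsym F t s p Data.Bool.≟ true) (allPlacements n))

module _ (K : FiniteField) where
  open FiniteField K

  Matrix : ℕ → Set
  Matrix n = Vec (Vec Carrier n) n

  entry : {n : ℕ} → Matrix n → Fin n → Fin n → Carrier
  entry M i j = lookup (lookup M i) j

  allMatrices : (n : ℕ) → List (Matrix n)
  allMatrices n = allVecs (allVecs elements n) n

  isZeroᶠ : Carrier → Bool
  isZeroᶠ x = does (x ≟ 0#)

  zeroVec : (n : ℕ) → Vec Carrier n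
  zeroVec zero = []
  zeroVec (suc n) = 0# ∷ zeroVec n

  _+ᵛ_ : {n : ℕ} → Vec Carrier n → Vec Carrier n → Vec Carrier n
  [] +ᵛ [] = []
  (x ∷ xs) +ᵛ (y ∷ ys) = (x +ᶠ y) ∷ (xs +ᵛ ys)

  scale : {n : ℕ} → Carrier → Vec Carrier n → Vec Carrier n
  scale c [] = []
  scale c (x ∷ xs) = (c *ᶠ x) ∷ scale c xs

  lincomb : {n : ℕ} → List Carrier → List (Vec Carrier n) → Vec Carrier n
  lincomb {n} (c ∷ cs) (v ∷ vs) = scale c v +ᵛ lincomb cs vs
  lincomb {n} _ _ = zeroVec n

  linIndep : {n : ℕ} → List (Vec Carrier n) → Bool
  linIndep vs = all (λ cs → not (all isZeroᶠ (toList (lincomb cs vs))) ∨ all isZeroᶠ cs)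
                    (allLists elements (length vs))

  selectRows : {n m : ℕ} → Vec Bool m → Vec (Vec Carrier n) m → List (Vec Carrier n)
  selectRows [] [] = []
  selectRows (true ∷ bs) (r ∷ rs) = r ∷ selectRows bs rs
  selectRows (false ∷ bs) (r ∷ rs) = selectRows bs rs

  rank : {n : ℕ} → Matrix n → ℕ
  rank {n} M = maximum (map (λ S → if linIndep (selectRows S M) then length (selectRows S M) else 0)
                            (allVecs (true ∷ false ∷ []) n))

  isSymmetricMatrix : {n : ℕ} → Matrix n → Bool
  isSymmetricMatrix {n} M = all (λ c → does (entry M (proj₁ c) (proj₂ c) ≟ entry M (proj₂ c) (proj₁ c))) (cells n)

  supportIn : {n : ℕ} → Diagram n → Matrix n → Bool
  supportIn {n} F M = all (λ c → isZeroᶠ (entry M (proj₁ c) (proj₂ c)) ∨ F (proj₁ c) (proj₂ c)) (cells n)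

  W : {n : ℕ} → Diagram n → ℤ → ℕ
  W {n} F (+ r)    = count (λ M → isSymmetricMatrix M ∧ supportIn F M ∧ (rank M ≡ᵇ r)) (allMatrices n)
  W {n} F -[1+ r ] = 0

-- Exact arithmetic in ℕ[√q]:  (a , b) denotes the real number a + b√q.

ℕ√ : Set
ℕ√ = ℕ × ℕ

_⊕_ : ℕ√ → ℕ√ → ℕ√
(a , b) ⊕ (c , d) = (a + c , b + d)

_⊙_ : ℕ → ℕ√ → ℕ√
k ⊙ (a , b) = (k * a , k * b)

Σ√ : List ℕ√ → ℕ√
Σ√ = foldr _⊕_ (0 , 0)

sqrtPow : ℕ → ℕ → ℕ√
sqrtPow q zero    = (1 , 0)
sqrtPow q (suc e) = (q * proj₂ (sqrtPow q e) , proj₁ (sqrtPow q e))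

-- w = a + b√q as real numbers (exact, since √q ≥ 0)
_≈√[_]_ : ℕ → ℕ → ℕ√ → Set
w ≈√[ q ] (a , b) = (a ≤ w) × ((w ∸ a) * (w ∸ a) ≡ q * (b * b))

pairsFor : ℤ → List (ℕ × ℕ)
pairsFor -[1+ r ] = []
pairsFor (+ r)    = map (λ t → (t , r ∸ (2 * t)))
                        (filter (λ t → (2 * t) Data.Nat.≤? r) (upTo (suc r)))

scaledRHS : {n : ℕ} → ℕ → Diagram n → ℤ → ℕ√
scaledRHS q F r = Σ√ (map (λ ts → let t = proj₁ ts ; s = proj₂ ts in
    ((q ∸ 1) ^ (t + s)) ⊙ Σ√ (map (λ e → sqrtPow q ((size F ∸ e) + 3 * t + s)) (RsymExps F t s)))
  (pairsFor r))

{-# OPTIONS --safe #-}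
module Submission where

-- Remove the first row and column. A symmetric matrix M of rank r, bordered by a row v and a
-- corner x, has rank r + 2 if v is outside the row space of M, and otherwise v = w M and the
-- rank is r or r + 1 according as x = w · v or not. Since the row space has q^r elements, all
-- supported in the first row of the diagram (which is the longest), the number of borderings of
-- each rank depends only on r and on the length of that row. A symmetric placement of r rooks
-- extends to the first row and column by no rook, a diagonal rook, or a symmetric pair in the
-- k-th unoccupied column, which attack r, r and r + k further cells above the diagonal; the
-- weights (q - 1)^(t + s) q^h sum up to the same three numbers. Finally |F| - inv(F, P) =
-- 2 h + t + s, so only even powers of √q occur.

open import Algebra.Bundles using (CommutativeRing)
import Algebra.Properties.Ring
import Algebra.Solver.Ring.NaturalCoefficients.Default
open import Algebra.Structures using (IsCommutativeRing)
import Data.Bool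
open import Data.Bool using (Bool; _∧_; _∨_; false; if_then_else_; not; true)
import Data.Bool.Properties as Bool
open import Data.Empty using (⊥-elim)
import Data.Fin as Fin
open import Data.Fin using (Fin; suc; zero)
import Data.Fin.Properties as Fin
import Data.Integer as ℤ
open import Data.Integer using (ℤ; ∣_∣)
open import Data.List using (List; []; [_]; _++_; _∷_; allFin; concatMap; filter; length; map; upTo)
open import Data.List.Membership.Propositional using (_∈_)
open import Data.List.Membership.Propositional.Properties using (∈-allFin; ∈-map⁺; ∈-upTo⁺)
import Data.List.Properties as List
open import Data.List.Relation.Unary.All using (All; []; _∷_)
open import Data.List.Relation.Unary.AllPairs using ([]; _∷_)
open import Data.List.Relation.Unary.Any using (here; there)
open import Data.List.Relation.Unary.Unique.Propositional using (Unique)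
open import Data.List.Relation.Unary.Unique.Propositional.Properties using (allFin⁺; upTo⁺)
import Data.Maybe as Maybe
open import Data.Maybe using (Maybe; is-just; is-nothing; just; nothing)
import Data.Maybe.Properties as Maybe
import Data.Nat as ℕ
open import Data.Nat using (_*_; _+_; _<_; _^_; _∸_; _≡ᵇ_; _≤_; suc; s≤s; zero; z≤n; ℕ)
open import Data.Nat.Properties hiding (_≟_)
open import Data.Nat.Solver using (module +-*-Solver)
open import Data.Product using (_,_; _×_; proj₁; proj₂; ∃)
open import Data.Product.Properties using (,-injective) renaming (≡-dec to ×-≡-dec)
open import Data.Sum using (_⊎_; inj₁; inj₂)
open import Data.Unit using (tt; ⊤)
import Data.Vec as Vec
open import Data.Vec using (Vec; []; _∷_; fromList; lookup; toList)
import Data.Vec.Properties as Vec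
open import Defs
open import Function using (Equivalence; _⇔_; _∘_; id; mk⇔)
open import Level using (0ℓ)
open import Relation.Binary.Definitions using (DecidableEquality)
open import Relation.Binary.PropositionalEquality hiding ([_])
open import Relation.Nullary using (Dec; does; no; yes; ¬_)
open import Relation.Nullary.Decidable using (_×-dec_; dec-false; dec-true; does-⇔)

-- Finite sums

-- Deleting the border mixes the ranks `r`, `1 + r`, `2 + r`, so an induction at a fixed rank does
-- not close. Both sides are therefore tested against arbitrary functions, `ψ` of the rank and `φ`
-- of the rook statistics, and a deletion replaces the test function by `bordered q c ψ` or
-- `attached c φ`. Both recursions then unfold over the same list `types F`, and the matching is
-- local: `weight-extend` (a geometric sum) and `value-extend`. No map from matrices to placements
-- is constructed. The rank of the statement is a maximum over selections of rows, which is hard to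
-- follow through a bordering. It is traded for the number of vectors of the row space, which is
-- compared through spans and determines the rank because `1 < q`. When a vector lies outside a
-- span, the decision procedure returns a functional that separates it. For symmetric `M` such a
-- functional is a left kernel vector of `M`; this is why a row outside the row space raises the
-- rank twice, once as a column and once as a row.

∑ : {A : Set} → List A → (A → ℕ) → ℕ
∑ []       f = 0
∑ (x ∷ xs) f = f x + ∑ xs f

infix 5 ∑-syntax
∑-syntax = ∑
syntax ∑-syntax xs (λ x → e) = ∑[ x ∈ xs ] e

𝟙 : Bool → ℕ
𝟙 true  = 1
𝟙 false = 0

does-≟-true : ∀ b → does (b Data.Bool.≟ true) ≡ b
does-≟-true true  = refl
does-≟-true false = refl

module _ {A : Set} where

  ∑-cong : {f g : A → ℕ} → (∀ x → f x ≡ g x) → ∀ xs → ∑ xs f ≡ ∑ xs g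
  ∑-cong eq []       = refl
  ∑-cong eq (x ∷ xs) = cong₂ _+_ (eq x) (∑-cong eq xs)

  ∑-mono : {f g : A → ℕ} → (∀ x → f x ≤ g x) → ∀ xs → ∑ xs f ≤ ∑ xs g
  ∑-mono le []       = z≤n
  ∑-mono le (x ∷ xs) = +-mono-≤ (le x) (∑-mono le xs)

  ∑-zero : ∀ (xs : List A) → ∑[ x ∈ xs ] 0 ≡ 0
  ∑-zero []       = refl
  ∑-zero (x ∷ xs) = ∑-zero xs

  ∑-one : ∀ (xs : List A) → ∑[ x ∈ xs ] 1 ≡ length xs
  ∑-one []       = refl
  ∑-one (x ∷ xs) = cong suc (∑-one xs)

  ∑-+ : (f g : A → ℕ) → ∀ xs → ∑[ x ∈ xs ] (f x + g x) ≡ ∑ xs f + ∑ xs g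
  ∑-+ f g []       = refl
  ∑-+ f g (x ∷ xs) rewrite ∑-+ f g xs =
    +-*-Solver.solve 4 (λ a b c d → (a :+ b) :+ (c :+ d) := (a :+ c) :+ (b :+ d)) refl (f x) (g x) (∑ xs f) (∑ xs g)
    where open +-*-Solver

  ∑-*ˡ : ∀ k (f : A → ℕ) xs → ∑[ x ∈ xs ] (k * f x) ≡ k * ∑ xs f
  ∑-*ˡ k f []       = sym (*-zeroʳ k)
  ∑-*ˡ k f (x ∷ xs) = trans (cong (k * f x +_) (∑-*ˡ k f xs)) (sym (*-distribˡ-+ k (f x) (∑ xs f)))

  ∑-*ʳ : ∀ k (f : A → ℕ) xs → ∑[ x ∈ xs ] (f x * k) ≡ ∑ xs f * k
  ∑-*ʳ k f xs = trans (∑-cong (λ x → *-comm (f x) k) xs) (trans (∑-*ˡ k f xs) (*-comm k _))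

  ∑-++ : ∀ (f : A → ℕ) xs ys → ∑ (xs ++ ys) f ≡ ∑ xs f + ∑ ys f
  ∑-++ f []       ys = refl
  ∑-++ f (x ∷ xs) ys = trans (cong (f x +_) (∑-++ f xs ys)) (sym (+-assoc (f x) _ _))

  ∑-filter : {P : A → Set} (P? : ∀ x → Dec (P x)) (f : A → ℕ) → ∀ xs →
    ∑ (filter P? xs) f ≡ ∑[ x ∈ xs ] (𝟙 (does (P? x)) * f x)
  ∑-filter P? f [] = refl
  ∑-filter P? f (x ∷ xs) with does (P? x)
  ... | true  = cong₂ _+_ (sym (+-identityʳ (f x))) (∑-filter P? f xs)
  ... | false = ∑-filter P? f xs

  count≡∑ : ∀ (p : A → Bool) xs → count p xs ≡ ∑ xs (𝟙 ∘ p)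
  count≡∑ p xs = trans (sym (∑-one (filter (λ x → p x Data.Bool.≟ true) xs))) (trans (∑-filter _ _ xs)
    (∑-cong (λ x → trans (*-identityʳ _) (cong 𝟙 (does-≟-true (p x)))) xs))

module _ {A B : Set} where

  ∑-swap : ∀ (f : A → B → ℕ) xs ys →
    ∑[ x ∈ xs ] (∑[ y ∈ ys ] f x y) ≡ ∑[ y ∈ ys ] (∑[ x ∈ xs ] f x y)
  ∑-swap f []       ys = sym (∑-zero ys)
  ∑-swap f (x ∷ xs) ys =
    trans (cong (∑ ys (f x) +_) (∑-swap f xs ys)) (sym (∑-+ (f x) _ ys))

  ∑-map : ∀ (h : A → B) (f : B → ℕ) xs → ∑ (map h xs) f ≡ ∑ xs (f ∘ h)
  ∑-map h f []       = refl
  ∑-map h f (x ∷ xs) = cong (f (h x) +_) (∑-map h f xs)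

  ∑-concatMap : ∀ (h : A → List B) (f : B → ℕ) xs → ∑ (concatMap h xs) f ≡ ∑[ x ∈ xs ] ∑ (h x) f
  ∑-concatMap h f []       = refl
  ∑-concatMap h f (x ∷ xs) =
    trans (∑-++ f (h x) (concatMap h xs)) (cong (∑ (h x) f +_) (∑-concatMap h f xs))

∑-allVecs : {A : Set} (xs : List A) (n : ℕ) (f : Vec A (suc n) → ℕ) →
  ∑ (allVecs xs (suc n)) f ≡ ∑[ x ∈ xs ] (∑[ v ∈ allVecs xs n ] f (x ∷ v))
∑-allVecs xs n f = trans (∑-concatMap _ f xs) (∑-cong (λ x → ∑-map (x ∷_) f (allVecs xs n)) xs)

∑-allFin : ∀ {n} (f : Fin (suc n) → ℕ) → ∑ (allFin (suc n)) f ≡ f zero + ∑ (allFin n) (f ∘ suc)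
∑-allFin {n} f = cong (f zero +_)
  (trans (cong (λ is → ∑ is f) (sym (List.map-tabulate id suc))) (∑-map suc f (allFin n)))

∑-pairs : {A B : Set} (xs : List A) (ys : List B) (f : A × B → ℕ) →
  ∑ (concatMap (λ a → map (a ,_) ys) xs) f ≡ ∑[ a ∈ xs ] (∑[ b ∈ ys ] f (a , b))
∑-pairs xs ys f = trans (∑-concatMap _ f xs) (∑-cong (λ a → ∑-map (a ,_) f ys) xs)

∑-cells : ∀ {n} (f : Fin n → Fin n → ℕ) →
  ∑[ c ∈ cells n ] f (proj₁ c) (proj₂ c) ≡ ∑[ i ∈ allFin n ] (∑[ j ∈ allFin n ] f i j)
∑-cells {n} f = ∑-pairs (allFin n) (allFin n) _

-- Indicators

𝟙-∧ : ∀ a b → 𝟙 (a ∧ b) ≡ 𝟙 a * 𝟙 b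
𝟙-∧ true  b = sym (+-identityʳ (𝟙 b))
𝟙-∧ false b = refl

𝟙-split : ∀ a b → 𝟙 a ≡ 𝟙 (a ∧ b) + 𝟙 (a ∧ not b)
𝟙-split true  true  = refl
𝟙-split true  false = refl
𝟙-split false b     = refl

𝟙-not : ∀ a → 𝟙 a + 𝟙 (not a) ≡ 1
𝟙-not true  = refl
𝟙-not false = refl

bool-ext : ∀ {a b : Bool} → (a ≡ true → b ≡ true) → (b ≡ true → a ≡ true) → a ≡ b
bool-ext {true}  {b}     f g = sym (f refl)
bool-ext {false} {true}  f g = g refl
bool-ext {false} {false} f g = refl

does≡true : {P : Set} (d : Dec P) → does d ≡ true → P
does≡true (yes p) _ = p

-- Enumerated finite types

-- `once` merges completeness and absence of repetitions into the single form in which sums consume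
-- them, a Kronecker delta of total mass 1. The instances are arranged so that their `list` is
-- definitionally the enumeration used in the statement (`allVecs`, `cells`, `allPlacements`).
record Enum (A : Set) : Set where
  infix 4 _≟_
  field
    list : List A
    _≟_  : DecidableEquality A
    once : ∀ a → ∑[ x ∈ list ] 𝟙 (does (x ≟ a)) ≡ 1

  ∑-point : ∀ a (f : A → ℕ) → ∑[ x ∈ list ] (𝟙 (does (x ≟ a)) * f x) ≡ f a
  ∑-point a f = trans (∑-cong at list)
    (trans (∑-*ʳ (f a) (λ x → 𝟙 (does (x ≟ a))) list)
      (trans (cong (_* f a) (once a)) (*-identityˡ (f a))))
    where
    at : ∀ x → 𝟙 (does (x ≟ a)) * f x ≡ 𝟙 (does (x ≟ a)) * f a
    at x with x ≟ a
    ... | yes refl = refl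
    ... | no _     = refl

  ∑-except : ∀ a k → ∑[ x ∈ list ] (𝟙 (not (does (x ≟ a))) * k) ≡ (length list ∸ 1) * k
  ∑-except a k = trans (∑-*ʳ k (λ x → 𝟙 (not (does (x ≟ a)))) list) (cong (_* k) (begin
    s                        ≡⟨ sym (m+n∸m≡n 1 s) ⟩
    1 + s ∸ 1                ≡⟨ cong (λ z → z + s ∸ 1) (sym (once a)) ⟩
    ∑ list is + s ∸ 1        ≡⟨ cong (_∸ 1) (sym (∑-+ is isn't list)) ⟩
    (∑[ x ∈ list ] (is x + isn't x)) ∸ 1 ≡⟨ cong (_∸ 1) (∑-cong (λ x → 𝟙-not (does (x ≟ a))) list) ⟩
    (∑[ x ∈ list ] 1) ∸ 1       ≡⟨ cong (_∸ 1) (∑-one list) ⟩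
    length list ∸ 1          ∎))
    where
    open ≡-Reasoning
    is isn't : A → ℕ
    is x    = 𝟙 (does (x ≟ a))
    isn't x = 𝟙 (not (does (x ≟ a)))
    s = ∑ list isn't

open Enum using (list; ∑-point; ∑-except)

unique⇒once : {A : Set} (_≟_ : DecidableEquality A) {xs : List A} → Unique xs →
  ∀ {a} → a ∈ xs → ∑[ x ∈ xs ] 𝟙 (does (x ≟ a)) ≡ 1
unique⇒once {A} _≟_ (x∉ ∷ u) {a} (here refl) = cong₂ _+_ (cong 𝟙 (dec-true (a ≟ a) refl)) (absent x∉)
  where
  absent : ∀ {xs} → All (λ x → ¬ (a ≡ x)) xs → ∑[ x ∈ xs ] 𝟙 (does (x ≟ a)) ≡ 0
  absent []       = refl
  absent {x ∷ _} (a≢x ∷ ps) = cong₂ _+_ (cong 𝟙 (dec-false (x ≟ a) (a≢x ∘ sym))) (absent ps)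
unique⇒once _≟_ {x ∷ xs} (x∉ ∷ u) {a} (there a∈) =
  cong₂ _+_ (cong 𝟙 (dec-false (x ≟ a) (differs x∉ a∈))) (unique⇒once _≟_ u a∈)
  where
  differs : ∀ {xs} → All (λ y → ¬ (x ≡ y)) xs → a ∈ xs → ¬ (x ≡ a)
  differs (p ∷ ps) (here refl) = p
  differs (p ∷ ps) (there m)   = differs ps m

Enum-Fin : ∀ n → Enum (Fin n)
Enum-Fin n = record
  { list = allFin n
  ; _≟_  = Fin._≟_
  ; once = λ a → unique⇒once Fin._≟_ (allFin⁺ n) (∈-allFin a)
  }

Enum-Bool : Enum Bool
Enum-Bool = record
  { list = true ∷ false ∷ []
  ; _≟_  = Data.Bool._≟_
  ; once = λ { true → refl ; false → refl }
  }

Enum-Maybe : {A : Set} → Enum A → Enum (Maybe A)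
Enum-Maybe {A} E = record
  { list = nothing ∷ map just (list E)
  ; _≟_  = _≟ᵐ_
  ; once = once′
  }
  where
  open Enum E using (_≟_; once)
  _≟ᵐ_ = Maybe.≡-dec _≟_
  once′ : ∀ a → ∑[ x ∈ nothing ∷ map just (list E) ] 𝟙 (does (x ≟ᵐ a)) ≡ 1
  once′ nothing  = cong suc (trans (∑-map just _ (list E)) (∑-zero (list E)))
  once′ (just a) = trans (∑-map just _ (list E))
    (trans (∑-cong (λ x → cong 𝟙 (does-⇔ (mk⇔ Maybe.just-injective (cong just)) (just x ≟ᵐ just a) (x ≟ a))) (list E))
      (once a))

Enum-Vec : {A : Set} → Enum A → ∀ n → Enum (Vec A n)
Enum-Vec {A} E n = record { list = allVecs (list E) n ; _≟_ = _≟ᵛ_ ; once = once′ n }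
  where
  open Enum E using (_≟_; once)
  _≟ᵛ_ : ∀ {n} → DecidableEquality (Vec A n)
  _≟ᵛ_ = Vec.≡-dec _≟_
  cons : ∀ {n} x a (v w : Vec A n) →
    𝟙 (does ((x ∷ v) ≟ᵛ (a ∷ w))) ≡ 𝟙 (does (x ≟ a)) * 𝟙 (does (v ≟ᵛ w))
  cons x a v w = 𝟙-∧ (does (x ≟ a)) (does (v ≟ᵛ w))
  once′ : ∀ n (a : Vec A n) → ∑[ v ∈ allVecs (list E) n ] 𝟙 (does (v ≟ᵛ a)) ≡ 1
  once′ zero    []      = refl
  once′ (suc n) (a ∷ w) = begin
    ∑[ v ∈ allVecs (list E) (suc n) ] 𝟙 (does (v ≟ᵛ (a ∷ w)))
      ≡⟨ ∑-allVecs (list E) n _ ⟩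
    ∑[ x ∈ list E ] (∑[ v ∈ allVecs (list E) n ] 𝟙 (does ((x ∷ v) ≟ᵛ (a ∷ w))))
      ≡⟨ ∑-cong (λ x → trans (∑-cong (λ v → cons x a v w) (allVecs (list E) n)) (∑-*ˡ (𝟙 (does (x ≟ a))) _
          (allVecs (list E) n))) (list E) ⟩
    ∑[ x ∈ list E ] (𝟙 (does (x ≟ a)) * (∑[ v ∈ allVecs (list E) n ] 𝟙 (does (v ≟ᵛ w))))
      ≡⟨ ∑-point E a _ ⟩
    ∑[ v ∈ allVecs (list E) n ] 𝟙 (does (v ≟ᵛ w))
      ≡⟨ once′ n w ⟩
    1 ∎
    where open ≡-Reasoning

Enum-× : {A B : Set} → Enum A → Enum B → Enum (A × B)
Enum-× {A} {B} EA EB = record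
  { list = concatMap (λ a → map (a ,_) (list EB)) (list EA)
  ; _≟_  = _≟ₚ_
  ; once = λ { (a , b) → trans (∑-pairs (list EA) (list EB) _)
      (trans (∑-cong (λ x → trans (∑-cong (pair x a b) (list EB)) (∑-*ˡ (𝟙 (does (x ≟₁ a))) _ (list EB))) (list EA))
        (trans (∑-point EA a _) (Enum.once EB b))) }
  }
  where
  open Enum EA using () renaming (_≟_ to _≟₁_)
  open Enum EB using () renaming (_≟_ to _≟₂_)
  _≟ₚ_ : DecidableEquality (A × B)
  _≟ₚ_ = ×-≡-dec _≟₁_ _≟₂_
  pair : ∀ x a b y → 𝟙 (does ((x , y) ≟ₚ (a , b))) ≡ 𝟙 (does (x ≟₁ a)) * 𝟙 (does (y ≟₂ b))
  pair x a b y = trans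
    (cong 𝟙 (does-⇔ (mk⇔ ,-injective (λ { (p , r) → cong₂ _,_ p r })) ((x , y) ≟ₚ (a , b)) ((x ≟₁ a) ×-dec (y ≟₂ b))))
    (𝟙-∧ (does (x ≟₁ a)) (does (y ≟₂ b)))

module _ {X Y : Set} (EX : Enum X) (EY : Enum Y) where
  open Enum EX using () renaming (_≟_ to _≟ˣ_)
  open Enum EY using () renaming (_≟_ to _≟ʸ_)

  -- Both sides equal the sum of f x over the pairs (x , y) with x ≡ e y and y ≡ d x.
  reindex : (e : Y → X) (d : X → Y) (f : X → ℕ) → (∀ x → ¬ (f x ≡ 0) → e (d x) ≡ x) →
    ∑ (list EX) f ≡ ∑[ y ∈ list EY ] (𝟙 (does (d (e y) ≟ʸ y)) * f (e y))
  reindex e d f supp = begin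
    ∑ (list EX) f
      ≡⟨ ∑-cong (λ x → sym (row x)) (list EX) ⟩
    ∑[ x ∈ list EX ] (∑[ y ∈ list EY ] h x y)
      ≡⟨ ∑-swap h (list EX) (list EY) ⟩
    ∑[ y ∈ list EY ] (∑[ x ∈ list EX ] h x y)
      ≡⟨ ∑-cong (λ y → ∑-point EX (e y) (λ x → 𝟙 (does (d x ≟ʸ y)) * f x)) (list EY) ⟩
    ∑[ y ∈ list EY ] (𝟙 (does (d (e y) ≟ʸ y)) * f (e y)) ∎
    where
    open ≡-Reasoning
    h : X → Y → ℕ
    h x y = 𝟙 (does (x ≟ˣ e y)) * (𝟙 (does (d x ≟ʸ y)) * f x)
    flip : ∀ x y → h x y ≡ 𝟙 (does (y ≟ʸ d x)) * (𝟙 (does (x ≟ˣ e y)) * f x)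
    flip x y rewrite does-⇔ (mk⇔ sym sym) (d x ≟ʸ y) (y ≟ʸ d x) =
      trans (sym (*-assoc a b (f x))) (trans (cong (_* f x) (*-comm a b)) (*-assoc b a (f x)))
      where
      a = 𝟙 (does (x ≟ˣ e y))
      b = 𝟙 (does (y ≟ʸ d x))
    row : ∀ x → ∑ (list EY) (h x) ≡ f x
    row x = trans (∑-cong (flip x) (list EY)) (trans (∑-point EY (d x) (λ y → 𝟙 (does (x ≟ˣ e y)) * f x)) last)
      where
      last : 𝟙 (does (x ≟ˣ e (d x))) * f x ≡ f x
      last with f x ℕ.≟ 0
      ... | yes fx≡0 = trans (cong (𝟙 (does (x ≟ˣ e (d x))) *_) fx≡0) (trans (*-zeroʳ (𝟙 (does (x ≟ˣ e (d x))))) (sym fx≡0))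
      ... | no fx≢0  = trans (cong (λ b → 𝟙 b * f x) (dec-true (x ≟ˣ e (d x)) (sym (supp x fx≢0)))) (+-identityʳ (f x))

-- Linear algebra over a finite field

module _ {A : Set} where

  all-sound : ∀ (p : A → Bool) xs → all p xs ≡ true → ∀ {x} → x ∈ xs → p x ≡ true
  all-sound p (x ∷ xs) eq m with p x in px
  all-sound p (x ∷ xs) eq (here refl) | true = px
  all-sound p (x ∷ xs) eq (there m)   | true = all-sound p xs eq m

  all-complete : ∀ (p : A → Bool) xs → (∀ x → p x ≡ true) → all p xs ≡ true
  all-complete p []       h = refl
  all-complete p (x ∷ xs) h rewrite h x = all-complete p xs h

  ∑≡1⇒∈ : ∀ (E : Enum A) {a} xs → ∑[ x ∈ xs ] 𝟙 (does (Enum._≟_ E x a)) ≡ 1 → a ∈ xs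
  ∑≡1⇒∈ E {a} (x ∷ xs) eq with Enum._≟_ E x a
  ... | yes refl = here refl
  ... | no _     = there (∑≡1⇒∈ E xs eq)

  enum-∈ : ∀ (E : Enum A) a → a ∈ list E
  enum-∈ E a = ∑≡1⇒∈ E (list E) (Enum.once E a)

  all-enum : ∀ (E : Enum A) (p : A → Bool) → all p (list E) ≡ true → ∀ a → p a ≡ true
  all-enum E p eq a = all-sound p (list E) eq (enum-∈ E a)

all-map : {A B : Set} (p : B → Bool) (f : A → B) (xs : List A) → all p (map f xs) ≡ all (p ∘ f) xs
all-map p f []       = refl
all-map p f (x ∷ xs) = cong (p (f x) ∧_) (all-map p f xs)

-- `linIndep` runs over coefficient lists, whereas the linear algebra below uses coefficient vectors
-- of known length.
allLists≡ : {A : Set} (xs : List A) (n : ℕ) → allLists xs n ≡ map toList (allVecs xs n)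
allLists≡ xs zero    = refl
allLists≡ xs (suc n) = trans (List.concatMap-cong row xs) (sym (List.map-concatMap toList _ xs))
  where
  row : ∀ x → map (x ∷_) (allLists xs n) ≡ map toList (map (x ∷_) (allVecs xs n))
  row x = trans (cong (map (x ∷_)) (allLists≡ xs n))
    (trans (sym (List.map-∘ (allVecs xs n))) (List.map-∘ (allVecs xs n)))

≤-maximum : ∀ {x} xs → x ∈ xs → x ≤ maximum xs
≤-maximum (x ∷ xs) (here refl) = m≤m⊔n x _
≤-maximum (x ∷ xs) (there m)   = ≤-trans (≤-maximum xs m) (m≤n⊔m x _)

maximum-map-≤ : {A : Set} (f : A → ℕ) {k : ℕ} (xs : List A) → (∀ x → f x ≤ k) → maximum (map f xs) ≤ k
maximum-map-≤ f []       h = z≤n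
maximum-map-≤ f (x ∷ xs) h = ⊔-lub (h x) (maximum-map-≤ f xs h)

module LinearAlgebra (K : FiniteField) where
  open FiniteField K
  module R = IsCommutativeRing isCommutativeRing

  commutativeRing : CommutativeRing 0ℓ 0ℓ
  commutativeRing = record { isCommutativeRing = isCommutativeRing }

  open Algebra.Properties.Ring (CommutativeRing.ring commutativeRing)
    using (-‿distribˡ-*)

  open Algebra.Solver.Ring.NaturalCoefficients.Default (CommutativeRing.commutativeSemiring commutativeRing)
    using (solve; _:+_; _:*_; _:=_)

  Row : ℕ → Set
  Row = Vec Carrier

  Rows : ℕ → ℕ → Set
  Rows k n = Vec (Row n) k

  𝟎 : ∀ {n} → Row n
  𝟎 {n} = zeroVec K n

  axpy : ∀ {n} → Carrier → Row n → Row n → Row n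
  axpy c x y = _+ᵛ_ K (scale K c x) y

  dot : ∀ {n} → Row n → Row n → Carrier
  dot []      []      = 0#
  dot (a ∷ u) (b ∷ v) = a *ᶠ b +ᶠ dot u v

  infix 8 _⋆_
  -- The product of a row vector and a matrix, by recursion on the rows so that it agrees with
  -- `lincomb` step by step.
  _⋆_ : ∀ {k n} → Row k → Rows k n → Row n
  []      ⋆ []      = 𝟎
  (c ∷ w) ⋆ (m ∷ M) = axpy c m (w ⋆ M)

  -c*x+[c*x+y]≡y : ∀ c x y → (-ᶠ c) *ᶠ x +ᶠ (c *ᶠ x +ᶠ y) ≡ y
  -c*x+[c*x+y]≡y c x y = begin
    (-ᶠ c) *ᶠ x +ᶠ (c *ᶠ x +ᶠ y)   ≡⟨ sym (R.+-assoc _ _ _) ⟩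
    ((-ᶠ c) *ᶠ x +ᶠ c *ᶠ x) +ᶠ y   ≡⟨ cong (_+ᶠ y) (sym (R.distribʳ x (-ᶠ c) c)) ⟩
    ((-ᶠ c) +ᶠ c) *ᶠ x +ᶠ y         ≡⟨ cong (λ z → z *ᶠ x +ᶠ y) (R.-‿inverseˡ c) ⟩
    0# *ᶠ x +ᶠ y                     ≡⟨ cong (_+ᶠ y) (R.zeroˡ x) ⟩
    0# +ᶠ y                           ≡⟨ R.+-identityˡ y ⟩
    y ∎
    where open ≡-Reasoning

  c*x+[-c*x+y]≡y : ∀ c x y → c *ᶠ x +ᶠ ((-ᶠ c) *ᶠ x +ᶠ y) ≡ y
  c*x+[-c*x+y]≡y c x y = trans
    (solve 3 (λ a b y → a :+ (b :+ y) := b :+ (a :+ y)) refl (c *ᶠ x) ((-ᶠ c) *ᶠ x) y)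
    (-c*x+[c*x+y]≡y c x y)

  axpy-cancel : ∀ {n} c (x y : Row n) → axpy (-ᶠ c) x (axpy c x y) ≡ y
  axpy-cancel c []      []      = refl
  axpy-cancel c (a ∷ x) (b ∷ y) = cong₂ _∷_ (-c*x+[c*x+y]≡y c a b) (axpy-cancel c x y)

  axpy-cancel′ : ∀ {n} c (x y : Row n) → axpy c x (axpy (-ᶠ c) x y) ≡ y
  axpy-cancel′ c []      []      = refl
  axpy-cancel′ c (a ∷ x) (b ∷ y) = cong₂ _∷_ (c*x+[-c*x+y]≡y c a b) (axpy-cancel′ c x y)

  axpy-0# : ∀ {n} (x y : Row n) → axpy 0# x y ≡ y
  axpy-0# []      []      = refl
  axpy-0# (a ∷ x) (b ∷ y) =
    cong₂ _∷_ (trans (cong (_+ᶠ b) (R.zeroˡ a)) (R.+-identityˡ b)) (axpy-0# x y)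

  axpy-1#-𝟎 : ∀ {n} (x : Row n) → axpy 1# x 𝟎 ≡ x
  axpy-1#-𝟎 []      = refl
  axpy-1#-𝟎 (a ∷ x) =
    cong₂ _∷_ (trans (R.+-identityʳ _) (R.*-identityˡ a)) (axpy-1#-𝟎 x)

  axpy-𝟎 : ∀ {n} c (y : Row n) → axpy c 𝟎 y ≡ y
  axpy-𝟎 c []      = refl
  axpy-𝟎 c (b ∷ y) = cong₂ _∷_ (trans (cong (_+ᶠ b) (R.zeroʳ c)) (R.+-identityˡ b)) (axpy-𝟎 c y)

  axpy-𝟎-𝟎 : ∀ {n} c → axpy c (𝟎 {n}) 𝟎 ≡ 𝟎
  axpy-𝟎-𝟎 c = axpy-𝟎 c 𝟎

  axpy-axpy : ∀ {n} c a b (m X Y : Row n) →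
    axpy (c *ᶠ a +ᶠ b) m (axpy c X Y) ≡ axpy c (axpy a m X) (axpy b m Y)
  axpy-axpy c a b []      []      []      = refl
  axpy-axpy c a b (m ∷ ms) (X ∷ Xs) (Y ∷ Ys) = cong₂ _∷_
    (solve 6 (λ a b c m X Y → (c :* a :+ b) :* m :+ (c :* X :+ Y) := c :* (a :* m :+ X) :+ (b :* m :+ Y)) refl a b c m X Y)
    (axpy-axpy c a b ms Xs Ys)

  dot-comm : ∀ {n} (u v : Row n) → dot u v ≡ dot v u
  dot-comm []      []      = refl
  dot-comm (a ∷ u) (b ∷ v) = cong₂ _+ᶠ_ (R.*-comm a b) (dot-comm u v)

  dot-axpyʳ : ∀ {n} (u : Row n) c x y → dot u (axpy c x y) ≡ c *ᶠ dot u x +ᶠ dot u y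
  dot-axpyʳ []      c []      []      = sym (trans (R.+-identityʳ _) (R.zeroʳ c))
  dot-axpyʳ (a ∷ u) c (x ∷ xs) (y ∷ ys) = trans (cong (a *ᶠ (c *ᶠ x +ᶠ y) +ᶠ_) (dot-axpyʳ u c xs ys))
    (solve 6 (λ a c x y X Y → a :* (c :* x :+ y) :+ (c :* X :+ Y) := c :* (a :* x :+ X) :+ (a :* y :+ Y))
      refl a c x y (dot u xs) (dot u ys))

  dot-axpyˡ : ∀ {n} c (x y v : Row n) → dot (axpy c x y) v ≡ c *ᶠ dot x v +ᶠ dot y v
  dot-axpyˡ c x y v = trans (dot-comm (axpy c x y) v) (trans (dot-axpyʳ v c x y)
    (cong₂ (λ a b → c *ᶠ a +ᶠ b) (dot-comm v x) (dot-comm v y)))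

  dot-𝟎ʳ : ∀ {n} (u : Row n) → dot u 𝟎 ≡ 0#
  dot-𝟎ʳ []      = refl
  dot-𝟎ʳ (a ∷ u) = trans (cong₂ _+ᶠ_ (R.zeroʳ a) (dot-𝟎ʳ u)) (R.+-identityʳ 0#)

  dot-⋆ : ∀ {k n} (u : Row n) (w : Row k) (M : Rows k n) → dot u (w ⋆ M) ≡ dot w (Vec.map (dot u) M)
  dot-⋆ u []      []      = dot-𝟎ʳ u
  dot-⋆ u (c ∷ w) (m ∷ M) = trans (dot-axpyʳ u c m (w ⋆ M)) (cong (c *ᶠ dot u m +ᶠ_) (dot-⋆ u w M))

  ⋆-axpy : ∀ {k n} c (w w′ : Row k) (M : Rows k n) → axpy c w w′ ⋆ M ≡ axpy c (w ⋆ M) (w′ ⋆ M)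
  ⋆-axpy c []      []       []      = sym (axpy-𝟎-𝟎 c)
  ⋆-axpy c (a ∷ w) (b ∷ w′) (m ∷ M) =
    trans (cong (axpy (c *ᶠ a +ᶠ b) m) (⋆-axpy c w w′ M)) (axpy-axpy c a b m (w ⋆ M) (w′ ⋆ M))

  𝟎-⋆ : ∀ {k n} (M : Rows k n) → 𝟎 ⋆ M ≡ 𝟎
  𝟎-⋆ []      = refl
  𝟎-⋆ (m ∷ M) = trans (axpy-0# m (𝟎 ⋆ M)) (𝟎-⋆ M)

  map-dot-axpy : ∀ {k n} c (u u′ : Row n) (M : Rows k n) →
    Vec.map (dot (axpy c u u′)) M ≡ axpy c (Vec.map (dot u) M) (Vec.map (dot u′) M)
  map-dot-axpy c u u′ []      = refl
  map-dot-axpy c u u′ (m ∷ M) = cong₂ _∷_ (dot-axpyˡ c u u′ m) (map-dot-axpy c u u′ M)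

  -- Row spaces and separating functionals

  Span : ∀ {k n} → Rows k n → Row n → Set
  Span M v = ∃ λ w → w ⋆ M ≡ v

  -- A positive witness of non-membership. The value 1, rather than merely a nonzero one, makes `u`
  -- read off the coefficient of `v` in any combination of `v` and rows of `M`.
  Separated : ∀ {k n} → Rows k n → Row n → Set
  Separated M v = ∃ λ u → Vec.map (dot u) M ≡ 𝟎 × dot u v ≡ 1#

  ⟂-Span : ∀ {k n} {M : Rows k n} {v} u → Vec.map (dot u) M ≡ 𝟎 → Span M v → dot u v ≡ 0#
  ⟂-Span {M = M} u u⟂M (w , refl) = trans (dot-⋆ u w M) (trans (cong (dot w) u⟂M) (dot-𝟎ʳ w))

  separated⇒∉ : ∀ {k n} {M : Rows k n} {v} → Separated M v → ¬ Span M v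
  separated⇒∉ (u , u⟂M , uv≡1) s = 0≢1 (trans (sym (⟂-Span u u⟂M s)) uv≡1)

  nonzero-functional : ∀ {n} (v : Row n) → (v ≡ 𝟎) ⊎ (∃ λ u → dot u v ≡ 1#)
  nonzero-functional [] = inj₁ refl
  nonzero-functional (a ∷ v) with a ≟ 0#
  ... | no a≢0 with inverse a a≢0
  ...   | b , ab≡1 = inj₂ (b ∷ 𝟎 ,
    trans (cong₂ _+ᶠ_ (trans (R.*-comm b a) ab≡1) (trans (dot-comm 𝟎 v) (dot-𝟎ʳ v))) (R.+-identityʳ 1#))
  nonzero-functional (a ∷ v) | yes refl with nonzero-functional v
  ... | inj₁ refl       = inj₁ refl
  ... | inj₂ (u , uv≡1) = inj₂ (0# ∷ u , trans (cong (_+ᶠ dot u v) (R.zeroˡ 0#)) (trans (R.+-identityˡ _) uv≡1))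

  -- Recursion on the rows replaces Gaussian elimination. If `m` depends on `M`, it changes nothing.
  -- If `u` separates `m` from `M`, then subtracting `dot u v` times `m` from `v` removes the
  -- component along `m`, and the question about `v` becomes one about the remainder and `M` alone.
  span⊎separated : ∀ {k n} (M : Rows k n) v → Span M v ⊎ Separated M v
  span⊎separated [] v with nonzero-functional v
  ... | inj₁ refl       = inj₁ ([] , refl)
  ... | inj₂ (u , uv≡1) = inj₂ (u , refl , uv≡1)
  span⊎separated (m ∷ M) v with span⊎separated M m
  ... | inj₁ m∈ with span⊎separated M v
  ...   | inj₁ (w , eq)           = inj₁ (0# ∷ w , trans (axpy-0# m _) eq)
  ...   | inj₂ (u , u⟂M , uv≡1) = inj₂ (u , cong₂ _∷_ (⟂-Span u u⟂M m∈) u⟂M , uv≡1)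
  span⊎separated (m ∷ M) v | inj₂ (u , u⟂M , um≡1)
    with span⊎separated M (axpy (-ᶠ dot u v) m v)
  ... | inj₁ (w , eq) = inj₁ (dot u v ∷ w , trans (cong (axpy (dot u v) m) eq) (axpy-cancel′ (dot u v) m v))
  ... | inj₂ (t , t⟂M , tv′≡1) = inj₂ (axpy c u t , cong₂ _∷_ at-m at-M , at-v)
    where
    open ≡-Reasoning
    -- The functional `t` for the remainder need not vanish on `m`; this multiple of `u` corrects
    -- that. On `v` the correction is `-(t · m)(u · v)`, which is exactly what turns `t · v` into
    -- `t` of the remainder, that is, 1.
    c = -ᶠ dot t m
    at-m : dot (axpy c u t) m ≡ 0#
    at-m = begin
      dot (axpy c u t) m         ≡⟨ dot-axpyˡ c u t m ⟩
      c *ᶠ dot u m +ᶠ dot t m    ≡⟨ cong (λ z → c *ᶠ z +ᶠ dot t m) um≡1 ⟩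
      c *ᶠ 1# +ᶠ dot t m         ≡⟨ cong (_+ᶠ dot t m) (R.*-identityʳ c) ⟩
      c +ᶠ dot t m               ≡⟨ R.-‿inverseˡ _ ⟩
      0# ∎
    at-M : Vec.map (dot (axpy c u t)) M ≡ 𝟎
    at-M = trans (map-dot-axpy c u t M) (trans (cong₂ (axpy c) u⟂M t⟂M) (axpy-𝟎-𝟎 c))
    at-v : dot (axpy c u t) v ≡ 1#
    at-v = begin
      dot (axpy c u t) v                          ≡⟨ dot-axpyˡ c u t v ⟩
      (-ᶠ dot t m) *ᶠ dot u v +ᶠ dot t v          ≡⟨ cong (_+ᶠ dot t v) (sym (-‿distribˡ-* _ _)) ⟩
      (-ᶠ (dot t m *ᶠ dot u v)) +ᶠ dot t v        ≡⟨ cong (λ z → (-ᶠ z) +ᶠ dot t v) (R.*-comm _ _) ⟩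
      (-ᶠ (dot u v *ᶠ dot t m)) +ᶠ dot t v        ≡⟨ cong (_+ᶠ dot t v) (-‿distribˡ-* _ _) ⟩
      (-ᶠ dot u v) *ᶠ dot t m +ᶠ dot t v          ≡⟨ sym (dot-axpyʳ t (-ᶠ dot u v) m v) ⟩
      dot t (axpy (-ᶠ dot u v) m v)               ≡⟨ tv′≡1 ⟩
      1# ∎

  span? : ∀ {k n} (M : Rows k n) v → Dec (Span M v)
  span? M v with span⊎separated M v
  ... | inj₁ s = yes s
  ... | inj₂ s = no (separated⇒∉ s)

  span-axpy : ∀ {k n} {M : Rows k n} c {x y} → Span M x → Span M y → Span M (axpy c x y)
  span-axpy {M = M} c (w , refl) (w′ , refl) = axpy c w w′ , ⋆-axpy c w w′ M

  span-∷⇒span : ∀ {k n} {m} {M : Rows k n} {v} → Span M m → Span (m ∷ M) v → Span M v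
  span-∷⇒span {M = M} m∈ (c ∷ w , refl) = span-axpy {M = M} c m∈ (w , refl)

  span⇒span-∷ : ∀ {k n} {m} {M : Rows k n} {v} → Span M v → Span (m ∷ M) v
  span⇒span-∷ {m = m} (w , refl) = 0# ∷ w , axpy-0# m _

  -- Sizes of row spaces, independence and the rank

  Enum-K : Enum Carrier
  Enum-K = record { list = elements ; _≟_ = _≟_ ; once = λ a → unique⇒once _≟_ unique (complete a) }

  Enum-Row : ∀ n → Enum (Row n)
  Enum-Row n = Enum-Vec Enum-K n

  q : ℕ
  q = order

  1<q : 1 < q
  1<q with elements | complete 0# | complete 1#
  ... | _ ∷ []     | here p    | here r    = ⊥-elim (0≢1 (trans p (sym r)))
  ... | _ ∷ _ ∷ _ | _ | _ = s≤s (s≤s z≤n)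

  instance
    q≢0 : ℕ.NonZero q
    q≢0 = ℕ.>-nonZero (<-trans (s≤s z≤n) 1<q)

  -- Stands in for the rank, its logarithm to base `q`: it involves no choice of rows and is
  -- monotone under inclusion of spans.
  card : ∀ {k n} → Rows k n → ℕ
  card {n = n} M = ∑[ v ∈ list (Enum-Row n) ] 𝟙 (does (span? M v))

  does-cong : ∀ {P Q : Set} (p? : Dec P) (q? : Dec Q) → (P → Q) → (Q → P) → does p? ≡ does q?
  does-cong p? q? f g = does-⇔ (mk⇔ f g) p? q?

  card-cong : ∀ {k k′ n} (M : Rows k n) (M′ : Rows k′ n) →
    (∀ {v} → Span M v → Span M′ v) → (∀ {v} → Span M′ v → Span M v) → card M ≡ card M′
  card-cong {n = n} M M′ f g =
    ∑-cong (λ v → cong 𝟙 (does-cong (span? M v) (span? M′ v) f g)) (list (Enum-Row n))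

  card-mono : ∀ {k k′ n} (M : Rows k n) (M′ : Rows k′ n) →
    (∀ {v} → Span M v → Span M′ v) → card M ≤ card M′
  card-mono {n = n} M M′ f = ∑-mono le (list (Enum-Row n))
    where
    le : ∀ v → 𝟙 (does (span? M v)) ≤ 𝟙 (does (span? M′ v))
    le v with span? M v
    ... | no _  = z≤n
    ... | yes s = ≤-reflexive (cong 𝟙 (sym (dec-true (span? M′ v) (f s))))

  card-[] : ∀ {n} → card {n = n} [] ≡ 1
  card-[] {n} = trans (∑-cong (λ v → cong 𝟙 (does-cong (span? [] v) (Enum._≟_ (Enum-Row n) v 𝟎)
    (λ { ([] , eq) → sym eq }) (λ { refl → [] , refl }))) (list (Enum-Row n))) (Enum.once (Enum-Row n) 𝟎)

  card-∷-in : ∀ {k n} {m} {M : Rows k n} → Span M m → card (m ∷ M) ≡ card M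
  card-∷-in {m = m} {M} m∈ = card-cong (m ∷ M) M (span-∷⇒span m∈) span⇒span-∷

  -- With u vanishing on M and u · m = 1, the row v = c m + y with y in the span of M
  -- determines c = u · v and y = v - c m.
  card-∷-out : ∀ {k n} {m} {M : Rows k n} → Separated M m → card (m ∷ M) ≡ q * card M
  card-∷-out {n = n} {m} {M} (u , u⟂M , um≡1) = begin
    card (m ∷ M)
      ≡⟨ reindex (Enum-Row n) EY e d (λ v → 𝟙 (does (span? (m ∷ M) v))) (λ v _ → axpy-cancel′ (dot u v) m v) ⟩
    ∑[ y ∈ list EY ] (𝟙 (does (d (e y) ≟ʸ y)) * 𝟙 (does (span? (m ∷ M) (e y))))
      ≡⟨ ∑-pairs elements (list (Enum-Row n)) _ ⟩
    ∑[ c ∈ elements ] (∑[ y ∈ list (Enum-Row n) ] (𝟙 (does (d (e (c , y)) ≟ʸ (c , y))) * 𝟙 (does (span? (m ∷ M) (e (c , y))))))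
      ≡⟨ ∑-cong (λ c → ∑-cong (term c) (list (Enum-Row n))) elements ⟩
    ∑[ c ∈ elements ] card M
      ≡⟨ ∑-cong (λ c → sym (*-identityˡ (card M))) elements ⟩
    ∑[ c ∈ elements ] (1 * card M)
      ≡⟨ trans (∑-*ʳ (card M) (λ _ → 1) elements) (cong (_* card M) (∑-one elements)) ⟩
    q * card M ∎
    where
    open ≡-Reasoning
    EY = Enum-× Enum-K (Enum-Row n)
    open Enum EY using () renaming (_≟_ to _≟ʸ_)
    e : Carrier × Row n → Row n
    e (c , y) = axpy c m y
    d : Row n → Carrier × Row n
    d v = dot u v , axpy (-ᶠ dot u v) m v
    u·e : ∀ c y → dot u y ≡ 0# → dot u (axpy c m y) ≡ c
    u·e c y uy≡0 = trans (dot-axpyʳ u c m y) (trans (cong₂ (λ a b → c *ᶠ a +ᶠ b) um≡1 uy≡0)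
      (trans (R.+-identityʳ _) (R.*-identityʳ c)))
    term : ∀ c y → 𝟙 (does (d (e (c , y)) ≟ʸ (c , y))) * 𝟙 (does (span? (m ∷ M) (e (c , y)))) ≡ 𝟙 (does (span? M y))
    term c y with span? M y
    ... | yes y∈@(w , refl) = cong₂ (λ a b → 𝟙 a * 𝟙 b)
            (dec-true (d (e (c , y)) ≟ʸ (c , y)) back)
            (dec-true (span? (m ∷ M) (e (c , y))) (c ∷ w , refl))
      where
      back : d (e (c , y)) ≡ (c , y)
      back rewrite u·e c y (⟂-Span {M = M} u u⟂M y∈) = cong (c ,_) (axpy-cancel c m y)
    ... | no y∉ with d (e (c , y)) ≟ʸ (c , y)
    ...   | no _  = refl
    ...   | yes p = trans (+-identityʳ _) (cong 𝟙 (dec-false (span? (m ∷ M) (e (c , y))) absurd))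
      where
      absurd : ¬ Span (m ∷ M) (e (c , y))
      absurd (c′ ∷ w , eq) = y∉ (w , trans (sym (axpy-cancel c m (w ⋆ M)))
        (trans (cong (λ z → axpy (-ᶠ c) m z) (trans (cong (λ z → axpy z m (w ⋆ M)) c≡c′) eq)) (axpy-cancel c m y)))
        where
        c≡c′ : c ≡ c′
        c≡c′ = trans (sym (cong proj₁ p)) (trans (cong (dot u) (sym eq)) (u·e c′ _ (⟂-Span {M = M} u u⟂M (w , refl))))

  -- A triangular form of linear independence: each row is separated from the later ones, so each
  -- row multiplies `card` by `q`. `Free` is the usual form, the one that `linIndep` tests.
  Indep : ∀ {k n} → Rows k n → Set
  Indep []      = ⊤
  Indep (m ∷ M) = Separated M m × Indep M

  card-indep : ∀ {k n} (M : Rows k n) → Indep M → card M ≡ q ^ k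
  card-indep {n = n} [] _      = card-[] {n}
  card-indep (m ∷ M) (s , ind) = trans (card-∷-out s) (cong (q *_) (card-indep M ind))

  Free : ∀ {k n} → Rows k n → Set
  Free M = ∀ w → w ⋆ M ≡ 𝟎 → w ≡ 𝟎

  free⇒indep : ∀ {k n} (M : Rows k n) → Free M → Indep M
  free⇒indep []      free = tt
  free⇒indep (m ∷ M) free = sep , free⇒indep M (λ w eq → Vec.∷-injectiveʳ (free (0# ∷ w) (trans (axpy-0# m _) eq)))
    where
    sep : Separated M m
    sep with span⊎separated M m
    ... | inj₂ s = s
    -- If `m` were `w ⋆ M`, then `-1` in front of `w` would be a relation among the rows, and
    -- freeness would force `-1 = 0`.
    ... | inj₁ (w , eq) = ⊥-elim (0≢1 (begin
      0#                ≡⟨ sym (R.-‿inverseˡ 1#) ⟩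
      (-ᶠ 1#) +ᶠ 1#     ≡⟨ cong (_+ᶠ 1#) (Vec.∷-injectiveˡ (free (-ᶠ 1# ∷ w) relation)) ⟩
      0# +ᶠ 1#          ≡⟨ R.+-identityˡ 1# ⟩
      1#                ∎))
      where
      open ≡-Reasoning
      relation : axpy (-ᶠ 1#) m (w ⋆ M) ≡ 𝟎
      relation = trans (cong (axpy (-ᶠ 1#) m) (trans eq (sym (axpy-1#-𝟎 m)))) (axpy-cancel 1# m 𝟎)

  indep⇒free : ∀ {k n} (M : Rows k n) → Indep M → Free M
  indep⇒free []      _ [] _ = refl
  indep⇒free (m ∷ M) ((u , u⟂M , um≡1) , ind) (c ∷ w) eq = cong₂ _∷_ c≡0
    (indep⇒free M ind w (trans (sym (axpy-0# m _)) (trans (cong (λ z → axpy z m (w ⋆ M)) (sym c≡0)) eq)))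
    where
    open ≡-Reasoning
    c≡0 : c ≡ 0#
    c≡0 = begin
      c                                ≡⟨ sym (trans (R.+-identityʳ _) (R.*-identityʳ c)) ⟩
      c *ᶠ 1# +ᶠ 0#                    ≡⟨ sym (cong₂ (λ a b → c *ᶠ a +ᶠ b) um≡1 (⟂-Span {M = M} u u⟂M (w , refl))) ⟩
      c *ᶠ dot u m +ᶠ dot u (w ⋆ M)    ≡⟨ sym (dot-axpyʳ u c m (w ⋆ M)) ⟩
      dot u (axpy c m (w ⋆ M))         ≡⟨ cong (dot u) eq ⟩
      dot u 𝟎                          ≡⟨ dot-𝟎ʳ u ⟩
      0# ∎

  lincomb≡⋆ : ∀ {n} (vs : List (Row n)) (w : Row (length vs)) → lincomb K (toList w) vs ≡ w ⋆ fromList vs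
  lincomb≡⋆ []       []      = refl
  lincomb≡⋆ (v ∷ vs) (c ∷ w) = cong (axpy c v) (lincomb≡⋆ vs w)

  allZero⇒≡𝟎 : ∀ {n} (v : Row n) → all (isZeroᶠ K) (toList v) ≡ true → v ≡ 𝟎
  allZero⇒≡𝟎 []      _  = refl
  allZero⇒≡𝟎 (a ∷ v) eq with a ≟ 0#
  ... | yes refl = cong (0# ∷_) (allZero⇒≡𝟎 v eq)

  allZero-𝟎 : ∀ n → all (isZeroᶠ K) (toList (𝟎 {n})) ≡ true
  allZero-𝟎 zero    = refl
  allZero-𝟎 (suc n) rewrite dec-true (0# ≟ 0#) refl = allZero-𝟎 n

  linIndep≡ : ∀ {n} (vs : List (Row n)) → linIndep K vs ≡
    all (λ w → not (all (isZeroᶠ K) (toList (w ⋆ fromList vs))) ∨ all (isZeroᶠ K) (toList w)) (list (Enum-Row (length vs)))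
  linIndep≡ vs = trans (cong (all _) (allLists≡ elements (length vs)))
    (trans (all-map _ toList (allVecs elements (length vs))) (all-cong (allVecs elements (length vs))))
    where
    all-cong : ∀ ws → all (λ w → not (all (isZeroᶠ K) (toList (lincomb K (toList w) vs))) ∨ all (isZeroᶠ K) (toList w)) ws
      ≡ all (λ w → not (all (isZeroᶠ K) (toList (w ⋆ fromList vs))) ∨ all (isZeroᶠ K) (toList w)) ws
    all-cong []       = refl
    all-cong (w ∷ ws) = cong₂ _∧_ (cong (λ z → not (all (isZeroᶠ K) (toList z)) ∨ all (isZeroᶠ K)
        (toList w)) (lincomb≡⋆ vs w)) (all-cong ws)

  linIndep⇒indep : ∀ {n} (vs : List (Row n)) → linIndep K vs ≡ true → Indep (fromList vs)
  linIndep⇒indep {n} vs eq = free⇒indep (fromList vs) free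
    where
    free : Free (fromList vs)
    free w w⋆≡𝟎 = allZero⇒≡𝟎 w (trans
      (cong (λ b → not b ∨ all (isZeroᶠ K) (toList w))
        (sym (trans (cong (λ v → all (isZeroᶠ K) (toList v)) w⋆≡𝟎) (allZero-𝟎 n))))
      (all-enum (Enum-Row (length vs)) _ (trans (sym (linIndep≡ vs)) eq) w))

  indep⇒linIndep : ∀ {n} (vs : List (Row n)) → Indep (fromList vs) → linIndep K vs ≡ true
  indep⇒linIndep {n} vs ind = trans (linIndep≡ vs) (all-complete _ (list (Enum-Row (length vs))) ok)
    where
    ok : ∀ w → not (all (isZeroᶠ K) (toList (w ⋆ fromList vs))) ∨ all (isZeroᶠ K) (toList w) ≡ true
    ok w with all (isZeroᶠ K) (toList (w ⋆ fromList vs)) in eq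
    ... | false = refl
    ... | true  = trans (cong (λ z → all (isZeroᶠ K) (toList z)) (indep⇒free (fromList vs) ind w
        (allZero⇒≡𝟎 _ eq))) (allZero-𝟎 (length vs))

  span-select : ∀ {k n} (S : Vec Bool k) (M : Rows k n) {v} → Span (fromList (selectRows K S M)) v → Span M v
  span-select []          []      s = s
  span-select (true ∷ S)  (m ∷ M) (c ∷ w , refl) with span-select S M (w , refl)
  ... | w′ , eq = c ∷ w′ , cong (axpy c m) eq
  span-select (false ∷ S) (m ∷ M) s = span⇒span-∷ (span-select S M s)

  -- Greedy selection from the last row upwards: a row is kept exactly when it lies outside the span
  -- of the rows after it.
  basis : ∀ {k n} (M : Rows k n) → ∃ λ S →
    Indep (fromList (selectRows K S M)) × (∀ {v} → Span M v → Span (fromList (selectRows K S M)) v)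
  basis [] = [] , tt , id
  basis (m ∷ M) with basis M | span⊎separated M m
  ... | S , ind , gen | inj₁ m∈ = false ∷ S , ind , gen ∘ span-∷⇒span m∈
  ... | S , ind , gen | inj₂ s  = true ∷ S , (sep , ind) , gen′
    where
    sep : Separated (fromList (selectRows K S M)) m
    sep with span⊎separated (fromList (selectRows K S M)) m
    ... | inj₁ m∈ = ⊥-elim (separated⇒∉ s (span-select S M m∈))
    ... | inj₂ s′ = s′
    gen′ : ∀ {v} → Span (m ∷ M) v → Span (fromList (selectRows K (true ∷ S) (m ∷ M))) v
    gen′ (c ∷ w , refl) with gen (w , refl)
    ... | w′ , eq = c ∷ w′ , cong (axpy c m) eq

  q^-cancel-≤ : ∀ {a b} → q ^ a ≤ q ^ b → a ≤ b
  q^-cancel-≤ le = ≮⇒≥ (λ b<a → <⇒≱ (^-monoʳ-< q 1<q b<a) le)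

  -- The selection given by `basis` spans the whole row space, so its length is the exponent. Any
  -- other independent selection spans a subspace, hence has at most as many elements, and exponents
  -- compare because `1 < q`.
  card≡q^rank : ∀ {n} (M : Matrix K n) → card M ≡ q ^ rank K M
  card≡q^rank {n} M with basis M
  ... | S , ind , gen = trans card≡ (cong (q ^_) (sym rank≡))
    where
    sel = selectRows K S M
    size-of : Vec Bool n → ℕ
    size-of S = if linIndep K (selectRows K S M) then length (selectRows K S M) else 0
    card≡ : card M ≡ q ^ length sel
    card≡ = trans (card-cong M (fromList sel) gen (span-select S M)) (card-indep (fromList sel) ind)
    upper : ∀ S′ → size-of S′ ≤ length sel
    upper S′ with linIndep K (selectRows K S′ M) in eq
    -- Dependent selections enter the maximum with the default value 0.
    ... | false = z≤n
    ... | true  = q^-cancel-≤ (≤-trans (≤-reflexive (sym (card-indep (fromList (selectRows K S′ M)) (linIndep⇒indep _ eq))))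
      (≤-trans (card-mono (fromList (selectRows K S′ M)) M (span-select S′ M)) (≤-reflexive card≡)))
    attained : size-of S ≡ length sel
    attained rewrite indep⇒linIndep sel ind = refl
    rank≡ : rank K M ≡ length sel
    rank≡ = ≤-antisym (maximum-map-≤ size-of (allVecs (true ∷ false ∷ []) n) upper)
      (≤-trans (≤-reflexive (sym attained))
        (≤-maximum (map size-of (allVecs (true ∷ false ∷ []) n)) (∈-map⁺ size-of (enum-∈ (Enum-Vec Enum-Bool n) S))))

  rank-from-card : ∀ {n} (M : Matrix K n) {r} → card M ≡ q ^ r → rank K M ≡ r
  rank-from-card M eq = ≤-antisym (q^-cancel-≤ (≤-reflexive e)) (q^-cancel-≤ (≤-reflexive (sym e)))
    where e = trans (sym (card≡q^rank M)) eq

-- Symmetric matrices supported in a Ferrers diagram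

inner : ∀ {n} → Diagram (suc n) → Diagram n
inner F i j = F (suc i) (suc j)

-- The corner is left out: it carries the free entry `x` of a bordering, while these cells carry the
-- row `v`.
arm : ∀ {n} → Diagram (suc n) → ℕ
arm {n} F = ∑[ j ∈ allFin n ] 𝟙 (F zero (suc j))

-- (t , d , h): t pairs of rooks off the diagonal, d rooks on it, h attacked cells above it.
-- With r = 2 t + d rooks in the inner diagram, the first row of a symmetric placement is empty,
-- or has a rook on the diagonal, or has one in the k-th of the arm F - r unoccupied columns.
Type : Set
Type = ℕ × ℕ × ℕ

extend : ℕ → Type → List Type
extend c (t , d , h) = (t , d , h + r) ∷ (t , suc d , h + r) ∷
  -- `k` starts at 0, so this is the rook pair in the free column number `suc k`.
  map (λ k → (suc t , d , h + r + suc k)) (upTo (c ∸ r))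
  where r = 2 * t + d

-- The common normal form of both sides, with one entry, repetitions included, for each symmetric
-- placement. A Ferrers diagram without its corner is empty and admits only the empty placement.
types : ∀ {n} → Diagram n → List Type
types {zero}  F = [ (0 , 0 , 0) ]
types {suc n} F = if F zero zero then concatMap (extend (arm F)) (types (inner F)) else [ (0 , 0 , 0) ]

types-true : ∀ {n} (F : Diagram (suc n)) → F zero zero ≡ true →
  types F ≡ concatMap (extend (arm F)) (types (inner F))
types-true F corner rewrite corner = refl

types-false : ∀ {n} (F : Diagram (suc n)) → F zero zero ≡ false → types F ≡ [ (0 , 0 , 0) ]
types-false F corner rewrite corner = refl

inner-ferrers : ∀ {n} (F : Diagram (suc n)) → IsFerrers F → IsFerrers (inner F)
inner-ferrers F fer i j s t f s≤i t≤j = fer (suc i) (suc j) (suc s) (suc t) f (s≤s s≤i) (s≤s t≤j)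

inner-symmetric : ∀ {n} (F : Diagram (suc n)) → IsSymmetricDiagram F → IsSymmetricDiagram (inner F)
inner-symmetric F sy i j = sy (suc i) (suc j)

Empty : ∀ {n} → Diagram n → Set
Empty F = ∀ i j → F i j ≡ false

corner-false⇒empty : ∀ {n} (F : Diagram (suc n)) → IsFerrers F → F zero zero ≡ false → Empty F
corner-false⇒empty F fer c i j with F i j in eq
... | false = refl
... | true with trans (sym c) (fer i j zero zero eq z≤n z≤n)
...   | ()

all-allFin : ∀ {n} (p : Fin (suc n) → Bool) → all p (allFin (suc n)) ≡ p zero ∧ all (p ∘ suc) (allFin n)
all-allFin {n} p = cong (p zero ∧_)
  (trans (cong (all p) (sym (List.map-tabulate id suc))) (all-map p suc (allFin n)))

∑-upTo : ∀ m (g : ℕ → ℕ) → ∑ (upTo (suc m)) g ≡ g 0 + ∑ (upTo m) (g ∘ suc)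
∑-upTo m g = cong (g 0 +_) (trans (cong (λ ks → ∑ ks g) (sym (List.map-upTo suc m))) (∑-map suc g (upTo m)))

lookup-ext : ∀ {A : Set} {n} (v w : Vec A n) → (∀ i → lookup v i ≡ lookup w i) → v ≡ w
lookup-ext v w eq = trans (sym (Vec.tabulate∘lookup v)) (trans (Vec.tabulate-cong eq) (Vec.tabulate∘lookup w))

Enum-cells : ∀ n → Enum (Fin n × Fin n)
Enum-cells n = Enum-× (Enum-Fin n) (Enum-Fin n)

all-cells : ∀ {n} (p : Fin n × Fin n → Bool) → all p (cells n) ≡ true → ∀ i j → p (i , j) ≡ true
all-cells {n} p eq i j = all-enum (Enum-cells n) p eq (i , j)

∧-true : ∀ {a b} → a ∧ b ≡ true → a ≡ true × b ≡ true
∧-true {true} {true} _ = refl , refl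

geometric : ∀ p m → p * (∑[ k ∈ upTo m ] suc p ^ k) + 1 ≡ suc p ^ m
geometric p zero    = cong (_+ 1) (*-zeroʳ p)
geometric p (suc m) = begin
  p * (∑[ k ∈ upTo (suc m) ] suc p ^ k) + 1
    ≡⟨ cong (λ s → p * s + 1) (trans (∑-upTo m (suc p ^_)) (cong suc (∑-*ˡ (suc p) (suc p ^_) (upTo m)))) ⟩
  p * suc (suc p * s) + 1
    ≡⟨ +-*-Solver.solve 2 (λ p s → p :* (con 1 :+ (con 1 :+ p) :* s) :+ con 1 := (con 1 :+ p) :* (p :* s :+ con 1)) refl p s ⟩
  suc p * (p * s + 1)
    ≡⟨ cong (suc p *_) (geometric p m) ⟩
  suc p ^ suc m ∎
  where
  open ≡-Reasoning
  open +-*-Solver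
  s = ∑[ k ∈ upTo m ] suc p ^ k

-- A geometric sum starting at exponent `r`. It equates the number of rows outside the row space
-- with a sum over free columns. For `c ≤ r` the sum is empty and the truncated difference is 0.
power-gap : ∀ p c r → p * (suc p ^ r * (∑[ k ∈ upTo (c ∸ r) ] suc p ^ k)) ≡ suc p ^ c ∸ suc p ^ r
power-gap p c r with ≤-total r c
... | inj₁ r≤c = sym (begin
  suc p ^ c ∸ suc p ^ r
    ≡⟨ cong (λ e → suc p ^ e ∸ suc p ^ r) (sym (m+[n∸m]≡n r≤c)) ⟩
  suc p ^ (r + (c ∸ r)) ∸ suc p ^ r
    ≡⟨ cong (_∸ suc p ^ r) (^-distribˡ-+-* (suc p) r (c ∸ r)) ⟩
  suc p ^ r * suc p ^ (c ∸ r) ∸ suc p ^ r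
    ≡⟨ cong (λ z → suc p ^ r * z ∸ suc p ^ r) (sym (geometric p (c ∸ r))) ⟩
  suc p ^ r * (p * s + 1) ∸ suc p ^ r
    ≡⟨ cong (_∸ suc p ^ r) (+-*-Solver.solve 3 (λ x p s → x :* (p :* s :+ con 1) := p :* (x :* s) :+ x) refl (suc p ^ r) p s) ⟩
  p * (suc p ^ r * s) + suc p ^ r ∸ suc p ^ r
    ≡⟨ m+n∸n≡m _ (suc p ^ r) ⟩
  p * (suc p ^ r * s) ∎)
  where
  open ≡-Reasoning
  open +-*-Solver
  s = ∑[ k ∈ upTo (c ∸ r) ] suc p ^ k
... | inj₂ c≤r rewrite m≤n⇒m∸n≡0 c≤r | m≤n⇒m∸n≡0 (^-monoʳ-≤ (suc p) c≤r) | *-zeroʳ (suc p ^ r) = *-zeroʳ p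

-- The sum of ψ (rank N) over the borderings N of a symmetric matrix of rank r, with a first
-- row supported in c + 1 cells.
bordered : ℕ → ℕ → (ℕ → ℕ) → ℕ → ℕ
bordered q c ψ r = q ^ r * (ψ r + (q ∸ 1) * ψ (1 + r)) + (q ^ c ∸ q ^ r) * (q * ψ (2 + r))

-- The share of one placement in the sum over matrices; a placement with `2 * t + d` rooks stands
-- for matrices of that rank.
weight : ℕ → (ℕ → ℕ) → Type → ℕ
weight q ψ (t , d , h) = (q ∸ 1) ^ (t + d) * q ^ h * ψ (2 * t + d)

-- The three kinds of extension give the three terms of `bordered`: no rook gives `ψ r`, a diagonal
-- rook gives `ψ (1 + r)` with a factor `q - 1`, and the pairs add up by `power-gap` to the
-- coefficient of `ψ (2 + r)`. Thus a step on types is moved onto the test function.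
weight-extend : ∀ q .{{_ : ℕ.NonZero q}} c ψ τ →
  ∑ (extend c τ) (weight q ψ) ≡ weight q (bordered q c ψ) τ
weight-extend (suc p) c ψ (t , d , h) = begin
  ∑ (extend c (t , d , h)) (weight (suc p) ψ)
    ≡⟨ cong (p ^ (t + d) * suc p ^ (h + r) * ψ r +_) (cong₂ _+_
         (cong₂ (λ a b → p ^ a * suc p ^ (h + r) * ψ b) (+-suc t d) (+-suc (2 * t) d)) pairs) ⟩
  p ^ (t + d) * suc p ^ (h + r) * ψ r + (p ^ suc (t + d) * suc p ^ (h + r) * ψ (suc r) + p ^ suc
      (t + d) * suc p ^ (h + r) * suc p * s * Z)
    ≡⟨ cong (λ z → p ^ (t + d) * z * ψ r + (p ^ suc (t + d) * z * ψ (suc r) + p ^ suc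
        (t + d) * z * suc p * s * Z)) (^-distribˡ-+-* (suc p) h r) ⟩
  p ^ (t + d) * (H * Q) * ψ r + (p * P * (H * Q) * ψ (suc r) + p * P * (H * Q) * suc p * s * Z)
    ≡⟨ +-*-Solver.solve 8 (λ p P H Q s x y z → P :* (H :* Q) :* x :+ (p :* P :* (H :* Q) :* y :+ p :* P :*
        (H :* Q) :* (con 1 :+ p) :* s :* z)
         := P :* H :* (Q :* (x :+ p :* y) :+ (p :* (Q :* s)) :* ((con 1 :+ p) :* z))) refl p P H Q s (ψ r) (ψ (suc r)) Z ⟩
  P * H * (Q * (ψ r + p * ψ (1 + r)) + (p * (Q * s)) * (suc p * Z))
    ≡⟨ cong (λ z → P * H * (Q * (ψ r + p * ψ (1 + r)) + z * (suc p * Z))) (power-gap p c r) ⟩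
  weight (suc p) (bordered (suc p) c ψ) (t , d , h) ∎
  where
  open ≡-Reasoning
  open +-*-Solver
  r = 2 * t + d
  P = p ^ (t + d)
  H = suc p ^ h
  Q = suc p ^ r
  Z = ψ (2 + r)
  s = ∑[ k ∈ upTo (c ∸ r) ] suc p ^ k
  -- The part of the weight that is independent of `k`; the last factor is the extra 1 in `suc k`,
  -- and it becomes the factor `q` in front of `ψ (2 + r)` in `bordered`.
  C = p ^ suc (t + d) * suc p ^ (h + r) * suc p
  pair : ∀ k → p ^ (suc t + d) * suc p ^ (h + r + suc k) * ψ (2 * suc t + d) ≡ C * suc p ^ k * Z
  pair k = cong₂ _*_ (trans (cong (p ^ suc (t + d) *_) (trans (^-distribˡ-+-* (suc p) (h + r) (suc k)) (sym
      (*-assoc (suc p ^ (h + r)) (suc p) (suc p ^ k)))))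
    (+-*-Solver.solve 4 (λ a b x y → a :* (b :* x :* y) := a :* b :* x :* y) refl (p ^ suc (t + d)) (suc p ^
        (h + r)) (suc p) (suc p ^ k)))
    (cong (λ z → ψ (z + d)) (*-suc 2 t))
  pairs : ∑ (map (λ k → (suc t , d , h + r + suc k)) (upTo (c ∸ r))) (weight (suc p) ψ) ≡ C * s * Z
  pairs = begin
    ∑ (map (λ k → (suc t , d , h + r + suc k)) (upTo (c ∸ r))) (weight (suc p) ψ)
      ≡⟨ ∑-map _ (weight (suc p) ψ) (upTo (c ∸ r)) ⟩
    ∑[ k ∈ upTo (c ∸ r) ] (p ^ (suc t + d) * suc p ^ (h + r + suc k) * ψ (2 * suc t + d))
      ≡⟨ ∑-cong pair (upTo (c ∸ r)) ⟩
    ∑[ k ∈ upTo (c ∸ r) ] (C * suc p ^ k * Z)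
      ≡⟨ ∑-*ʳ Z (λ k → C * suc p ^ k) (upTo (c ∸ r)) ⟩
    (∑[ k ∈ upTo (c ∸ r) ] (C * suc p ^ k)) * Z
      ≡⟨ cong (_* Z) (∑-*ˡ C (suc p ^_) (upTo (c ∸ r))) ⟩
    C * s * Z ∎

-- Rank of a bordered symmetric matrix

module SymmetricMatrices (K : FiniteField) where
  open FiniteField K
  open LinearAlgebra K

  Enum-Matrix : ∀ n → Enum (Matrix K n)
  Enum-Matrix n = Enum-Vec (Enum-Row n) n

  Symmetric : ∀ {n} → Matrix K n → Set
  Symmetric M = ∀ i j → entry K M i j ≡ entry K M j i

  symmetric-sound : ∀ {n} (M : Matrix K n) → isSymmetricMatrix K M ≡ true → Symmetric M
  symmetric-sound M eq i j = does≡true (_ ≟ _) (all-cells _ eq i j)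

  symmetric-complete : ∀ {n} (M : Matrix K n) → Symmetric M → isSymmetricMatrix K M ≡ true
  symmetric-complete {n} M s = all-complete _ (cells n) (λ { (i , j) → dec-true (_ ≟ _) (s i j) })

  lookup-axpy : ∀ {n} c (x y : Row n) j → lookup (axpy c x y) j ≡ c *ᶠ lookup x j +ᶠ lookup y j
  lookup-axpy c (a ∷ x) (b ∷ y) zero    = refl
  lookup-axpy c (a ∷ x) (b ∷ y) (suc j) = lookup-axpy c x y j

  lookup-𝟎 : ∀ {n} (j : Fin n) → lookup (𝟎 {n}) j ≡ 0#
  lookup-𝟎 zero    = refl
  lookup-𝟎 (suc j) = lookup-𝟎 j

  lookup-⋆ : ∀ {k n} (w : Row k) (M : Rows k n) j → lookup (w ⋆ M) j ≡ dot w (Vec.map (λ m → lookup m j) M)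
  lookup-⋆ []      []      j = lookup-𝟎 j
  lookup-⋆ (c ∷ w) (m ∷ M) j = trans (lookup-axpy c m (w ⋆ M) j) (cong (c *ᶠ lookup m j +ᶠ_) (lookup-⋆ w M j))

  -- Entry `j` of the product pairs `u` with column `j`, which is row `j`. Consequently a functional
  -- that kills the rows of `M` lies in the left kernel.
  ⋆-symmetric : ∀ {n} (u : Row n) (M : Matrix K n) → Symmetric M → u ⋆ M ≡ Vec.map (dot u) M
  ⋆-symmetric u M sy = lookup-ext _ _ λ j → trans (lookup-⋆ u M j)
    (trans (cong (dot u) (lookup-ext _ _ λ i → trans (Vec.lookup-map i _ M) (sy i j)))
      (sym (Vec.lookup-map j (dot u) M)))

  prepend : ∀ {k n} → Row k → Rows k n → Rows k (suc n)
  prepend = Vec.zipWith _∷_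

  border : ∀ {n} → Carrier → Row n → Matrix K n → Matrix K (suc n)
  border x v M = (x ∷ v) ∷ prepend v M

  ⋆-prepend : ∀ {k n} (u v : Row k) (M : Rows k n) → u ⋆ prepend v M ≡ dot u v ∷ u ⋆ M
  ⋆-prepend []      []      []      = refl
  ⋆-prepend (c ∷ u) (a ∷ v) (m ∷ M) = cong (axpy c (a ∷ m)) (⋆-prepend u v M)

  card-suc : ∀ {k n} (M : Rows k (suc n)) →
    card M ≡ ∑[ y ∈ list (Enum-Row n) ] (∑[ a ∈ elements ] 𝟙 (does (span? M (a ∷ y))))
  card-suc {n = n} M = trans (∑-allVecs elements n _) (∑-swap _ elements (list (Enum-Row n)))

  module _ {n} (M : Matrix K n) (sy : Symmetric M) where

    module _ (w : Row n) where

      -- Both sides are the value at `u` and `w` of the bilinear form of `M`, which is symmetric.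
      dot-w⋆M : ∀ u → dot u (w ⋆ M) ≡ dot w (u ⋆ M)
      dot-w⋆M u = trans (cong (dot u) (⋆-symmetric w M sy)) (sym (dot-⋆ w u M))

      -- When the new column comes from the row space, the first coordinate of a combination is a
      -- function of the others, by `dot-w⋆M`: adjoining the column leaves the size of the row space
      -- unchanged.
      span-prepend-in : ∀ {a y} → Span (prepend (w ⋆ M) M) (a ∷ y) ⇔ (a ≡ dot w y × Span M y)
      span-prepend-in {a} {y} = mk⇔ to from
        where
        to : Span (prepend (w ⋆ M) M) (a ∷ y) → a ≡ dot w y × Span M y
        to (u , eq) with trans (sym (⋆-prepend u (w ⋆ M) M)) eq
        ... | refl = dot-w⋆M u , u , refl
        from : a ≡ dot w y × Span M y → Span (prepend (w ⋆ M) M) (a ∷ y)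
        from (refl , u , refl) = u , trans (⋆-prepend u (w ⋆ M) M) (cong (_∷ u ⋆ M) (dot-w⋆M u))

      card-prepend-in : card (prepend (w ⋆ M) M) ≡ card M
      card-prepend-in = trans (card-suc (prepend (w ⋆ M) M)) (∑-cong term (list (Enum-Row n)))
        where
        term : ∀ y → ∑[ a ∈ elements ] 𝟙 (does (span? (prepend (w ⋆ M) M) (a ∷ y))) ≡ 𝟙 (does (span? M y))
        term y = trans (∑-cong (λ a → trans
            (cong 𝟙 (does-⇔ span-prepend-in (span? _ (a ∷ y)) ((a ≟ dot w y) ×-dec span? M y)))
            (𝟙-∧ (does (a ≟ dot w y)) _)) elements)
          (∑-point Enum-K (dot w y) _)

      rank-border-in : ∀ x → rank K (border x (w ⋆ M) M) ≡ (if does (x ≟ dot w (w ⋆ M)) then rank K M else suc (rank K M))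
      rank-border-in x with x ≟ dot w (w ⋆ M)
      ... | yes x≡ = rank-from-card (border x (w ⋆ M) M) (trans
          (card-∷-in {M = prepend (w ⋆ M) M} (Equivalence.from span-prepend-in (x≡ , w , refl)))
          (trans card-prepend-in (card≡q^rank M)))

      ... | no x≢ with span⊎separated (prepend (w ⋆ M) M) (x ∷ w ⋆ M)
      ...   | inj₁ s = ⊥-elim (x≢ (proj₁ (Equivalence.to span-prepend-in s)))

      ...   | inj₂ s = rank-from-card (border x (w ⋆ M) M)
          (trans (card-∷-out {M = prepend (w ⋆ M) M} s) (cong (q *_) (trans card-prepend-in (card≡q^rank M))))

    module _ (v : Row n) (sep : Separated M v) where

      -- The separating functional is a left kernel vector of `M` whose product with `v` is 1.
      -- Adding its multiples to the coefficients moves the first coordinate freely and leaves the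
      -- others fixed.
      span-prepend-out : ∀ {a y} → Span (prepend v M) (a ∷ y) ⇔ Span M y
      span-prepend-out {a} {y} = mk⇔ to from
        where
        to : Span (prepend v M) (a ∷ y) → Span M y
        to (u , eq) = u , Vec.∷-injectiveʳ (trans (sym (⋆-prepend u v M)) eq)
        from : Span M y → Span (prepend v M) (a ∷ y)
        from (u , refl) = axpy c u₀ u , trans (⋆-prepend (axpy c u₀ u) v M) (cong₂ _∷_ at-v at-M)
          where
          open ≡-Reasoning
          u₀ = proj₁ sep
          -- The first coordinate is `dot u v` before the correction and has to become `a`.
          c = (-ᶠ dot u v) +ᶠ a
          at-v : dot (axpy c u₀ u) v ≡ a
          at-v = begin
            dot (axpy c u₀ u) v              ≡⟨ dot-axpyˡ c u₀ u v ⟩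
            c *ᶠ dot u₀ v +ᶠ dot u v         ≡⟨ cong (λ z → c *ᶠ z +ᶠ dot u v) (proj₂ (proj₂ sep)) ⟩
            c *ᶠ 1# +ᶠ dot u v               ≡⟨ cong (_+ᶠ dot u v) (R.*-identityʳ c) ⟩
            (-ᶠ dot u v) +ᶠ a +ᶠ dot u v     ≡⟨ R.+-comm _ (dot u v) ⟩
            dot u v +ᶠ ((-ᶠ dot u v) +ᶠ a)   ≡⟨ sym (R.+-assoc _ _ a) ⟩
            dot u v +ᶠ (-ᶠ dot u v) +ᶠ a     ≡⟨ cong (_+ᶠ a) (R.-‿inverseʳ (dot u v)) ⟩
            0# +ᶠ a                          ≡⟨ R.+-identityˡ a ⟩
            a ∎
          at-M : axpy c u₀ u ⋆ M ≡ u ⋆ M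
          at-M = begin
            axpy c u₀ u ⋆ M                        ≡⟨ ⋆-axpy c u₀ u M ⟩
            axpy c (u₀ ⋆ M) (u ⋆ M)               ≡⟨ cong (λ z → axpy c z (u ⋆ M)) (trans
                (⋆-symmetric u₀ M sy) (proj₁ (proj₂ sep))) ⟩
            axpy c 𝟎 (u ⋆ M)                       ≡⟨ axpy-𝟎 c (u ⋆ M) ⟩
            u ⋆ M ∎

      card-prepend-out : card (prepend v M) ≡ q * card M
      card-prepend-out = begin
        card (prepend v M)
          ≡⟨ card-suc (prepend v M) ⟩
        ∑[ y ∈ list (Enum-Row n) ] (∑[ a ∈ elements ] 𝟙 (does (span? (prepend v M) (a ∷ y))))
          ≡⟨ ∑-cong (λ y → trans (∑-cong (λ a → trans
               (cong 𝟙 (does-⇔ span-prepend-out (span? (prepend v M) (a ∷ y)) (span? M y)))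
               (sym (*-identityˡ _))) elements)
               (trans (∑-*ʳ (𝟙 (does (span? M y))) (λ _ → 1) elements) (cong (_* 𝟙 (does (span? M y)))
                   (∑-one elements)))) (list (Enum-Row n)) ⟩
        ∑[ y ∈ list (Enum-Row n) ] (q * 𝟙 (does (span? M y)))
          ≡⟨ ∑-*ˡ q _ (list (Enum-Row n)) ⟩
        q * card M ∎
        where open ≡-Reasoning

      rank-border-out : ∀ x → rank K (border x v M) ≡ 2 + rank K M
      rank-border-out x with span⊎separated (prepend v M) (x ∷ v)
      ... | inj₁ s = ⊥-elim (separated⇒∉ sep (Equivalence.to span-prepend-out s))

      ... | inj₂ s = rank-from-card (border x v M) (trans (card-∷-out {M = prepend v M} s)
          (cong (q *_) (trans card-prepend-out (cong (q *_) (card≡q^rank M)))))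

    ∑-rank-border : ∀ (ψ : ℕ → ℕ) v → ∑[ x ∈ elements ] ψ (rank K (border x v M)) ≡
      𝟙 (does (span? M v)) * (ψ (rank K M) + (q ∸ 1) * ψ (1 + rank K M))
      + 𝟙 (not (does (span? M v))) * (q * ψ (2 + rank K M))
    ∑-rank-border ψ v with span⊎separated M v
    ... | inj₂ sep = begin
      ∑[ x ∈ elements ] ψ (rank K (border x v M))
        ≡⟨ ∑-cong (λ x → trans (cong ψ (rank-border-out v sep x)) (sym (*-identityˡ _))) elements ⟩
      ∑[ x ∈ elements ] (1 * ψ (2 + rank K M))
        ≡⟨ trans (∑-*ʳ (ψ (2 + rank K M)) (λ _ → 1) elements) (cong (_* ψ (2 + rank K M)) (∑-one elements)) ⟩
      q * ψ (2 + rank K M)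
        ≡⟨ sym (*-identityˡ _) ⟩
      1 * (q * ψ (2 + rank K M)) ∎
      where open ≡-Reasoning
    ... | inj₁ (w , refl) = begin
      ∑[ x ∈ elements ] ψ (rank K (border x (w ⋆ M) M))
        ≡⟨ ∑-cong term elements ⟩
      ∑[ x ∈ elements ] (𝟙 (does (x ≟ a)) * ψ r + 𝟙 (not (does (x ≟ a))) * ψ (suc r))
        ≡⟨ ∑-+ _ _ elements ⟩
      (∑[ x ∈ elements ] (𝟙 (does (x ≟ a)) * ψ r)) + (∑[ x ∈ elements ] (𝟙 (not (does (x ≟ a))) * ψ (suc r)))
        ≡⟨ cong₂ _+_ (∑-point Enum-K a _) (∑-except Enum-K a (ψ (suc r))) ⟩
      ψ r + (q ∸ 1) * ψ (suc r)
        ≡⟨ sym (trans (+-identityʳ _) (+-identityʳ _)) ⟩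
      1 * (ψ r + (q ∸ 1) * ψ (suc r)) + 0 ∎
      where
      open ≡-Reasoning
      r = rank K M
      a = dot w (w ⋆ M)
      term : ∀ x → ψ (rank K (border x (w ⋆ M) M)) ≡ 𝟙 (does (x ≟ a)) * ψ r + 𝟙 (not (does (x ≟ a))) * ψ (suc r)
      term x = trans (cong ψ (rank-border-in w x)) select
        where
        select : ψ (if does (x ≟ a) then r else suc r) ≡ 𝟙 (does (x ≟ a)) * ψ r + 𝟙 (not (does (x ≟ a))) * ψ (suc r)
        select with does (x ≟ a)
        ... | true  = sym (trans (+-identityʳ _) (+-identityʳ _))
        ... | false = sym (+-identityʳ _)

  -- Sums over the symmetric matrices supported in a diagram

  rowIn : ∀ {n} → (Fin n → Bool) → Row n → Bool
  rowIn {n} G v = all (λ j → isZeroᶠ K (lookup v j) ∨ G j) (allFin n)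

  ∑-rowIn : ∀ {n} (G : Fin n → Bool) → ∑[ v ∈ list (Enum-Row n) ] 𝟙 (rowIn G v) ≡ q ^ (∑[ j ∈ allFin n ] 𝟙 (G j))
  ∑-rowIn {zero}  G = refl
  ∑-rowIn {suc n} G = begin
    ∑[ v ∈ list (Enum-Row (suc n)) ] 𝟙 (rowIn G v)
      ≡⟨ ∑-allVecs elements n _ ⟩
    ∑[ x ∈ elements ] (∑[ v ∈ list (Enum-Row n) ] 𝟙 (rowIn G (x ∷ v)))
      ≡⟨ ∑-cong (λ x → trans (∑-cong (λ v → trans (cong 𝟙 (all-allFin {n} _)) (𝟙-∧ (isZeroᶠ K x ∨ G zero) _)) (list (Enum-Row n)))
           (∑-*ˡ (𝟙 (isZeroᶠ K x ∨ G zero)) _ (list (Enum-Row n)))) elements ⟩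
    ∑[ x ∈ elements ] (𝟙 (isZeroᶠ K x ∨ G zero) * (∑[ v ∈ list (Enum-Row n) ] 𝟙 (rowIn (G ∘ suc) v)))
      ≡⟨ ∑-*ʳ _ _ elements ⟩
    (∑[ x ∈ elements ] 𝟙 (isZeroᶠ K x ∨ G zero)) * (∑[ v ∈ list (Enum-Row n) ] 𝟙 (rowIn (G ∘ suc) v))
      ≡⟨ cong₂ _*_ first (∑-rowIn (G ∘ suc)) ⟩
    q ^ 𝟙 (G zero) * q ^ (∑[ j ∈ allFin n ] 𝟙 (G (suc j)))
      ≡⟨ sym (^-distribˡ-+-* q (𝟙 (G zero)) _) ⟩
    q ^ (𝟙 (G zero) + (∑[ j ∈ allFin n ] 𝟙 (G (suc j))))
      ≡⟨ cong (q ^_) (sym (∑-allFin (𝟙 ∘ G))) ⟩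
    q ^ (∑[ j ∈ allFin (suc n) ] 𝟙 (G j)) ∎
    where
    open ≡-Reasoning
    first : ∑[ x ∈ elements ] 𝟙 (isZeroᶠ K x ∨ G zero) ≡ q ^ 𝟙 (G zero)
    first with G zero
    ... | true  = trans (∑-cong (λ x → cong 𝟙 (Bool.∨-zeroʳ (isZeroᶠ K x))) elements) (trans
        (∑-one elements) (sym (*-identityʳ q)))
    ... | false = trans (∑-cong (λ x → cong 𝟙 (Bool.∨-identityʳ (isZeroᶠ K x))) elements) (Enum.once Enum-K 0#)

  isZero-sound : ∀ x {b} → isZeroᶠ K x ∨ b ≡ true → b ≡ false → x ≡ 0#
  isZero-sound x eq refl = does≡true (x ≟ 0#) (trans (sym (Bool.∨-identityʳ _)) eq)

  span⇒rowIn : ∀ {k n} (G : Fin n → Bool) (M : Rows k n) →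
    (∀ i j → isZeroᶠ K (lookup (lookup M i) j) ∨ G j ≡ true) → ∀ {v} → Span M v → rowIn G v ≡ true
  span⇒rowIn {n = n} G M supp (w , refl) = all-complete _ (allFin n) ok
    where
    ok : ∀ j → isZeroᶠ K (lookup (w ⋆ M) j) ∨ G j ≡ true
    ok j with G j in Gj
    ... | true  = Bool.∨-zeroʳ _
    ... | false = trans (Bool.∨-identityʳ _) (dec-true (_ ≟ 0#) (trans (lookup-⋆ w M j)
        (trans (cong (dot w) (lookup-ext _ _ λ i → trans (Vec.lookup-map i _ M)
          (trans (isZero-sound _ (supp i j) Gj) (sym (lookup-𝟎 i))))) (dot-𝟎ʳ w))))

  admissible : ∀ {n} → Diagram n → Matrix K n → Bool
  admissible F M = isSymmetricMatrix K M ∧ supportIn K F M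

  rankSum : ∀ {n} → Diagram n → (ℕ → ℕ) → ℕ
  rankSum {n} F ψ = ∑[ M ∈ list (Enum-Matrix n) ] (𝟙 (admissible F M) * ψ (rank K M))

  lookup-prepend : ∀ {k n} (v : Row k) (M : Rows k n) i → lookup (prepend v M) i ≡ lookup v i ∷ lookup M i
  lookup-prepend v M i = Vec.lookup-zipWith _∷_ i v M

  rankSum-empty : ∀ {n} (F : Diagram n) → Empty F → ∀ ψ → rankSum F ψ ≡ ψ 0
  rankSum-empty {n} F F≡∅ ψ = begin
    rankSum F ψ
      ≡⟨ ∑-cong (λ M → cong (λ b → 𝟙 b * ψ (rank K M)) (bool-ext (to M) (from M))) (list (Enum-Matrix n)) ⟩
    ∑[ M ∈ list (Enum-Matrix n) ] (𝟙 (does (M ≟ᴹ O)) * ψ (rank K M))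
      ≡⟨ ∑-point (Enum-Matrix n) O _ ⟩
    ψ (rank K O)
      ≡⟨ cong ψ (rank-from-card O (trans (card-cong O [] span-O (λ { ([] , refl) → 𝟎 , 𝟎-⋆ O })) (card-[] {n}))) ⟩
    ψ 0 ∎
    where
    open ≡-Reasoning
    open Enum (Enum-Matrix n) using () renaming (_≟_ to _≟ᴹ_)
    O : Matrix K n
    O = Vec.replicate n 𝟎
    entry-O : ∀ i j → entry K O i j ≡ 0#
    entry-O i j = trans (cong (λ m → lookup m j) (Vec.lookup-replicate i 𝟎)) (lookup-𝟎 j)
    to : ∀ M → admissible F M ≡ true → does (M ≟ᴹ O) ≡ true
    to M eq = dec-true (M ≟ᴹ O) (lookup-ext _ _ λ i → lookup-ext _ _ λ j →
      trans (isZero-sound _ (all-cells _ (proj₂ (∧-true eq)) i j) (F≡∅ i j)) (sym (entry-O i j)))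
    from : ∀ M → does (M ≟ᴹ O) ≡ true → admissible F M ≡ true
    from M eq with does≡true (M ≟ᴹ O) eq
    ... | refl = cong₂ _∧_ (symmetric-complete O (λ i j → trans (entry-O i j) (sym (entry-O j i))))
      (all-complete _ (cells n) (λ { (i , j) → cong (_∨ F i j) (dec-true (_ ≟ 0#) (entry-O i j)) }))
    ⋆-O : ∀ {k} (w : Row k) → w ⋆ Vec.replicate k (𝟎 {n}) ≡ 𝟎
    ⋆-O []      = refl
    ⋆-O (c ∷ w) = trans (cong (axpy c 𝟎) (⋆-O w)) (axpy-𝟎-𝟎 c)
    span-O : ∀ {v} → Span O v → Span [] v
    span-O (w , refl) = [] , sym (⋆-O w)

  module _ {n} (F : Diagram (suc n)) (fer : IsFerrers F) (syF : IsSymmetricDiagram F) (corner : F zero zero ≡ true) where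

    admissible-border : ∀ x v M →
      admissible F (border x v M) ≡ rowIn (F zero ∘ suc) v ∧ admissible (inner F) M
    admissible-border x v M = bool-ext to from
      where
      to : admissible F (border x v M) ≡ true → rowIn (F zero ∘ suc) v ∧ admissible (inner F) M ≡ true
      to eq with ∧-true eq
      ... | eq₁ , eq₂ = cong₂ _∧_ (all-complete _ (allFin n) (λ j → supp zero (suc j)))
          (cong₂ _∧_ (symmetric-complete M (λ i j → trans (sym (at i j)) (trans (symm (suc i) (suc j)) (at j i))))
            (all-complete _ (cells n) (λ { (i , j) → trans (cong (λ z → isZeroᶠ K z ∨ F (suc i) (suc j))
                (sym (at i j))) (supp (suc i) (suc j)) })))
        where
        symm = symmetric-sound (border x v M) eq₁
        supp = all-cells _ eq₂
        at : ∀ i j → entry K (border x v M) (suc i) (suc j) ≡ entry K M i j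
        at i j = cong (λ m → lookup m (suc j)) (lookup-prepend v M i)
      from : rowIn (F zero ∘ suc) v ∧ admissible (inner F) M ≡ true → admissible F (border x v M) ≡ true
      from eq with ∧-true eq
      ... | eq₀ , eq₁₂ with ∧-true eq₁₂
      ...   | eq₁ , eq₂ = cong₂ _∧_ (symmetric-complete (border x v M) symm) (all-complete _ (cells (suc n))
          (λ { (i , j) → supp i j }))
        where
        at : ∀ i j → entry K (border x v M) (suc i) j ≡ lookup (lookup v i ∷ lookup M i) j
        at i j = cong (λ m → lookup m j) (lookup-prepend v M i)
        symm : Symmetric (border x v M)
        symm zero    zero    = refl
        symm zero    (suc j) = sym (at j zero)
        symm (suc i) zero    = at i zero
        symm (suc i) (suc j) = trans (at i (suc j)) (trans (symmetric-sound M eq₁ i j) (sym (at j (suc i))))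
        F-symm : ∀ i → F zero (suc i) ≡ F (suc i) zero
        F-symm i = bool-ext (syF zero (suc i)) (syF (suc i) zero)
        in-v : ∀ j → isZeroᶠ K (lookup v j) ∨ F zero (suc j) ≡ true
        in-v = all-enum (Enum-Fin n) _ eq₀
        supp : ∀ i j → isZeroᶠ K (entry K (border x v M) i j) ∨ F i j ≡ true
        supp zero    zero    = trans (cong (isZeroᶠ K x ∨_) corner) (Bool.∨-zeroʳ _)
        supp zero    (suc j) = in-v j
        supp (suc i) zero    = trans (cong₂ (λ z b → isZeroᶠ K z ∨ b) (at i zero) (sym (F-symm i))) (in-v i)
        supp (suc i) (suc j) = trans (cong (λ z → isZeroᶠ K z ∨ F (suc i) (suc j)) (at i (suc j))) (all-cells _ eq₂ i j)

    rankSum-step : ∀ ψ → rankSum F ψ ≡ rankSum (inner F) (bordered q (arm F) ψ)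
    rankSum-step ψ = begin
      rankSum F ψ
        ≡⟨ reindex (Enum-Matrix (suc n)) EY e d f supp ⟩
      ∑[ y ∈ list EY ] (𝟙 (does (d (e y) ≟ʸ y)) * f (e y))
        ≡⟨ ∑-cong (λ y → trans (cong (λ b → 𝟙 b * f (e y)) (dec-true (d (e y) ≟ʸ y) (d∘e y))) (*-identityˡ _)) (list EY) ⟩
      ∑[ y ∈ list EY ] f (e y)
        ≡⟨ trans (∑-pairs (list (Enum-Matrix n)) _ _) (∑-cong (λ M → ∑-pairs (list (Enum-Row n)) elements _)
            (list (Enum-Matrix n))) ⟩
      ∑[ M ∈ list (Enum-Matrix n) ] (∑[ v ∈ list (Enum-Row n) ] (∑[ x ∈ elements ] f (border x v M)))
        ≡⟨ ∑-cong rows (list (Enum-Matrix n)) ⟩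
      rankSum (inner F) ψ* ∎
      where
      open ≡-Reasoning
      ψ* : ℕ → ℕ
      ψ* = bordered q (arm F) ψ
      EY = Enum-× (Enum-Matrix n) (Enum-× (Enum-Row n) Enum-K)
      open Enum EY using () renaming (_≟_ to _≟ʸ_)
      f : Matrix K (suc n) → ℕ
      f M = 𝟙 (admissible F M) * ψ (rank K M)
      e : Matrix K n × Row n × Carrier → Matrix K (suc n)
      e (M , v , x) = border x v M
      d : Matrix K (suc n) → Matrix K n × Row n × Carrier
      d ((x ∷ v) ∷ N) = Vec.map Vec.tail N , v , x
      d∘e : ∀ y → d (e y) ≡ y
      d∘e (M , v , x) = cong (_, v , x) (lookup-ext _ _ λ i →
        trans (Vec.lookup-map i Vec.tail (prepend v M)) (cong Vec.tail (lookup-prepend v M i)))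
      -- `d` forgets the first column below the corner. For a symmetric matrix the first row
      -- restores it; for any other matrix the summand is 0.
      supp : ∀ M → ¬ (f M ≡ 0) → e (d M) ≡ M
      supp M@((x ∷ v) ∷ N) f≢0 with isSymmetricMatrix K M in eq
      ... | false = ⊥-elim (f≢0 refl)
      ... | true  = cong ((x ∷ v) ∷_) (lookup-ext _ _ λ i →
          trans (lookup-prepend v _ i) (trans (cong₂ _∷_ (symmetric-sound M eq zero (suc i))
              (Vec.lookup-map i Vec.tail N)) (η (lookup N i))))
        where
        η : (m : Row (suc n)) → lookup m zero ∷ Vec.tail m ≡ m
        η (_ ∷ _) = refl
      rows : ∀ M → ∑[ v ∈ list (Enum-Row n) ] (∑[ x ∈ elements ] f (border x v M)) ≡ 𝟙 (admissible (inner F) M) * ψ* (rank K M)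
      rows M = trans (∑-cong (λ v → trans (∑-cong (λ x → cong (λ b → 𝟙 b * ψ (rank K (border x v M)))
          (admissible-border x v M)) elements)
          (∑-*ˡ (𝟙 (rowIn (F zero ∘ suc) v ∧ admissible (inner F) M)) _ elements)) (list (Enum-Row n))) inside-sum
        where
        inside-sum : ∑[ v ∈ list (Enum-Row n) ] (𝟙 (rowIn (F zero ∘ suc) v ∧ admissible (inner F) M) *
            (∑[ x ∈ elements ] ψ (rank K (border x v M))))
          ≡ 𝟙 (admissible (inner F) M) * ψ* (rank K M)
        inside-sum with admissible (inner F) M in adm
        ... | false = trans (∑-cong (λ v → cong (λ b → 𝟙 b * (∑[ x ∈ elements ] ψ (rank K (border x v M))))
            (Bool.∧-zeroʳ (rowIn (F zero ∘ suc) v))) (list (Enum-Row n))) (∑-zero (list (Enum-Row n)))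
        ... | true  = begin
          ∑[ v ∈ list (Enum-Row n) ] (𝟙 (R v ∧ true) * (∑[ x ∈ elements ] ψ (rank K (border x v M))))
            ≡⟨ ∑-cong (λ v → cong₂ (λ b s → 𝟙 b * s) (Bool.∧-identityʳ (R v)) (∑-rank-border M symm ψ v)) (list (Enum-Row n)) ⟩
          ∑[ v ∈ list (Enum-Row n) ] (𝟙 (R v) * (𝟙 (S v) * A + 𝟙 (not (S v)) * B))
            ≡⟨ ∑-cong (λ v → trans (*-distribˡ-+ (𝟙 (R v)) _ _) (cong₂ _+_ (assoc (R v) (S v) A) (assoc
                (R v) (not (S v)) B))) (list (Enum-Row n)) ⟩
          ∑[ v ∈ list (Enum-Row n) ] (𝟙 (R v ∧ S v) * A + 𝟙 (R v ∧ not (S v)) * B)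
            ≡⟨ trans (∑-+ _ _ (list (Enum-Row n))) (cong₂ _+_ (∑-*ʳ A _ (list (Enum-Row n))) (∑-*ʳ B _ (list (Enum-Row n)))) ⟩
          in-span * A + off-span * B
            ≡⟨ cong₂ (λ a b → a * A + b * B) in≡ off≡ ⟩
          q ^ r * A + (q ^ arm F ∸ q ^ r) * B
            ≡⟨ sym (*-identityˡ _) ⟩
          1 * ψ* r ∎
          where
          r = rank K M
          A = ψ r + (q ∸ 1) * ψ (1 + r)
          B = q * ψ (2 + r)
          R S : Row n → Bool
          R v = rowIn (F zero ∘ suc) v
          S v = does (span? M v)
          in-span  = ∑[ v ∈ list (Enum-Row n) ] 𝟙 (R v ∧ S v)
          off-span = ∑[ v ∈ list (Enum-Row n) ] 𝟙 (R v ∧ not (S v))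
          symm = symmetric-sound M (proj₁ (∧-true adm))
          assoc : ∀ a b k → 𝟙 a * (𝟙 b * k) ≡ 𝟙 (a ∧ b) * k
          assoc a b k = trans (sym (*-assoc (𝟙 a) (𝟙 b) k)) (cong (_* k) (sym (𝟙-∧ a b)))
          -- The Ferrers condition enters here: a cell of the inner diagram has the cell above it in
          -- the first row, so the whole row space of `M` fits into that row and `drop` below
          -- applies.
          rows-in : ∀ i j → isZeroᶠ K (entry K M i j) ∨ F zero (suc j) ≡ true
          rows-in i j with F (suc i) (suc j) in Fij | all-cells _ (proj₂ (∧-true adm)) i j
          ... | true  | _  = trans (cong (isZeroᶠ K (entry K M i j) ∨_) (fer (suc i) (suc j) zero
              (suc j) Fij z≤n ≤-refl)) (Bool.∨-zeroʳ _)
          ... | false | eq = cong (_∨ F zero (suc j)) (dec-true (_ ≟ 0#) (isZero-sound (entry K M i j) eq Fij))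
          in≡ : in-span ≡ q ^ r
          in≡ = trans (∑-cong (λ v → cong 𝟙 (drop v)) (list (Enum-Row n))) (card≡q^rank M)
            where
            drop : ∀ v → R v ∧ S v ≡ S v
            drop v with span? M v
            ... | yes s = cong (_∧ true) (span⇒rowIn (F zero ∘ suc) M rows-in s)
            ... | no _  = Bool.∧-zeroʳ (R v)
          -- The truncated difference is a true one, since the two counts add up to all rows
          -- supported in the arm.
          off≡ : off-span ≡ q ^ arm F ∸ q ^ r
          off≡ = begin
            off-span                      ≡⟨ sym (m+n∸m≡n in-span off-span) ⟩
            in-span + off-span ∸ in-span  ≡⟨ cong₂ _∸_ (trans (sym (∑-+ _ _ (list (Enum-Row n))))
              (trans (∑-cong (λ v → sym (𝟙-split (R v) (S v))) (list (Enum-Row n))) (∑-rowIn (F zero ∘ suc)))) in≡ ⟩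
            q ^ arm F ∸ q ^ r ∎

  rankSum-types : ∀ {n} (F : Diagram n) → IsFerrers F → IsSymmetricDiagram F → ∀ ψ →
    rankSum F ψ ≡ ∑ (types F) (weight q ψ)
  rankSum-types {zero}  F fer syF ψ = trans (rankSum-empty F (λ ()) ψ) (sym (trans (+-identityʳ _) (*-identityˡ _)))
  rankSum-types {suc n} F fer syF ψ = by-corner (F zero zero) refl
    where
    by-corner : ∀ b → F zero zero ≡ b → rankSum F ψ ≡ ∑ (types F) (weight q ψ)
    by-corner false corner = trans (rankSum-empty F (corner-false⇒empty F fer corner) ψ)
      (sym (trans (cong (λ τs → ∑ τs (weight q ψ)) (types-false F corner)) (trans (+-identityʳ _) (*-identityˡ _))))
    by-corner true corner = begin
      rankSum F ψ
        ≡⟨ rankSum-step F fer syF corner ψ ⟩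
      rankSum (inner F) (bordered q (arm F) ψ)
        ≡⟨ rankSum-types (inner F) (inner-ferrers F fer) (inner-symmetric F syF) (bordered q (arm F) ψ) ⟩
      ∑ (types (inner F)) (weight q (bordered q (arm F) ψ))
        ≡⟨ ∑-cong (λ τ → sym (weight-extend q (arm F) ψ τ)) (types (inner F)) ⟩
      ∑[ τ ∈ types (inner F) ] ∑ (extend (arm F) τ) (weight q ψ)
        ≡⟨ sym (∑-concatMap (extend (arm F)) (weight q ψ) (types (inner F))) ⟩
      ∑ (concatMap (extend (arm F)) (types (inner F))) (weight q ψ)
        ≡⟨ cong (λ τs → ∑ τs (weight q ψ)) (sym (types-true F corner)) ⟩
      ∑ (types F) (weight q ψ) ∎
      where open ≡-Reasoning

-- Symmetric rook placements

module _ {A : Set} where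

  any-sound : ∀ (p : A → Bool) xs → any p xs ≡ true → ∃ λ x → p x ≡ true
  any-sound p (x ∷ xs) eq with p x in px
  ... | true  = x , px
  ... | false = any-sound p xs eq

  any-complete : ∀ (p : A → Bool) xs {x} → x ∈ xs → p x ≡ true → any p xs ≡ true
  any-complete p (x ∷ xs) (here refl) px rewrite px = refl
  any-complete p (x ∷ xs) (there m)   px rewrite any-complete p xs m px = Bool.∨-zeroʳ (p x)

∨-true : ∀ a {b} → a ∨ b ≡ true → a ≡ true ⊎ b ≡ true
∨-true true  _  = inj₁ refl
∨-true false eq = inj₂ eq

implies-sound : ∀ {a b} → not a ∨ b ≡ true → a ≡ true → b ≡ true
implies-sound eq refl = eq

implies-complete : ∀ {a b} → (a ≡ true → b ≡ true) → not a ∨ b ≡ true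
implies-complete {true}  f = f refl
implies-complete {false} f = refl

rookAt-sound : ∀ {n} (p : Placement n) i j → rookAt p i j ≡ true → lookup p i ≡ just j
rookAt-sound p i j eq with lookup p i
... | just b = cong just (does≡true (b Fin.≟ j) eq)

rookAt-complete : ∀ {n} (p : Placement n) i j → lookup p i ≡ just j → rookAt p i j ≡ true
rookAt-complete p i j eq with lookup p i
rookAt-complete p i j refl | just .j = dec-true (j Fin.≟ j) refl

rookAt-ext : ∀ {m n} (p : Placement m) (p′ : Placement n) i j i′ j′ →
  (lookup p i ≡ just j → lookup p′ i′ ≡ just j′) → (lookup p′ i′ ≡ just j′ → lookup p i ≡ just j) →
  rookAt p i j ≡ rookAt p′ i′ j′
rookAt-ext p p′ i j i′ j′ f g = bool-ext
  (λ eq → rookAt-complete p′ i′ j′ (f (rookAt-sound p i j eq)))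
  (λ eq → rookAt-complete p i j (g (rookAt-sound p′ i′ j′ eq)))

Attacked : ∀ {n} → Placement n → Fin n → Fin n → Set
Attacked p i j = (∃ λ a → i Fin.≤ a × lookup p a ≡ just j) ⊎ (∃ λ b → j Fin.≤ b × lookup p i ≡ just b)

attacked-sound : ∀ {n} (p : Placement n) i j → attacked p i j ≡ true → Attacked p i j
attacked-sound {n} p i j eq with any-sound _ (cells n) eq
... | (a , b) , hit with ∧-true {rookAt p a b} hit
...   | rook , side with ∨-true ((b ==ᶠ j) ∧ (i ≤ᵇᶠ a)) side | rookAt-sound p a b rook
...     | inj₁ col | pa≡b with ∧-true {b ==ᶠ j} col
...       | b≡j , i≤a = inj₁ (a , does≡true (i Fin.≤? a) i≤a , trans pa≡b (cong just (does≡true (b Fin.≟ j) b≡j)))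
attacked-sound p i j eq | (a , b) , hit | rook , side | inj₂ row | pa≡b with ∧-true {a ==ᶠ i} row
... | a≡i , j≤b = inj₂ (b , does≡true (j Fin.≤? b) j≤b , trans (cong (lookup p) (sym (does≡true (a Fin.≟ i) a≡i))) pa≡b)

attacked-complete : ∀ {n} (p : Placement n) i j → Attacked p i j → attacked p i j ≡ true
attacked-complete {n} p i j (inj₁ (a , i≤a , pa≡j)) = any-complete _ (cells n) (enum-∈ (Enum-cells n) (a , j))
  (cong₂ _∧_ (rookAt-complete p a j pa≡j) (cong₂ (λ x y → (x ∧ y) ∨ ((a ==ᶠ i) ∧ (j ≤ᵇᶠ j))) (dec-true
      (j Fin.≟ j) refl) (dec-true (i Fin.≤? a) i≤a)))
attacked-complete {n} p i j (inj₂ (b , j≤b , pi≡b)) = any-complete _ (cells n) (enum-∈ (Enum-cells n) (i , b))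
  (cong₂ _∧_ (rookAt-complete p i b pi≡b) (trans (cong (((b ==ᶠ j) ∧ (i ≤ᵇᶠ i)) ∨_)
    (cong₂ _∧_ (dec-true (i Fin.≟ i) refl) (dec-true (j Fin.≤? b) j≤b))) (Bool.∨-zeroʳ _)))

record Good {n} (F : Diagram n) (p : Placement n) : Set where
  field
    in-diagram : ∀ i j → lookup p i ≡ just j → F i j ≡ true
    symmetric  : ∀ i j → lookup p i ≡ just j → lookup p j ≡ just i

open Good

good : ∀ {n} → Diagram n → Placement n → Bool
good F p = colInjective p ∧ inside F p ∧ offDiagSymmetric p

good-sound : ∀ {n} (F : Diagram n) p → good F p ≡ true → Good F p
good-sound {n} F p eq = record { in-diagram = ins ; symmetric = symm }
  where
  parts = ∧-true {colInjective p} eq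
  ins : ∀ i j → lookup p i ≡ just j → F i j ≡ true
  ins i j pi≡j = implies-sound (all-cells _ (proj₁ (∧-true {inside F p} (proj₂ parts))) i j) (rookAt-complete p i j pi≡j)
  symm : ∀ i j → lookup p i ≡ just j → lookup p j ≡ just i
  symm i j pi≡j with ∨-true (i ==ᶠ j) (implies-sound (all-cells _ (proj₂ (∧-true {inside F p}
      (proj₂ parts))) i j) (rookAt-complete p i j pi≡j))
  ... | inj₂ r = rookAt-sound p j i r
  ... | inj₁ e with does≡true (i Fin.≟ j) e
  ...   | refl = pi≡j

good-complete : ∀ {n} (F : Diagram n) p → Good F p → good F p ≡ true
good-complete {n} F p g = cong₂ _∧_ inj (cong₂ _∧_ ins symm)
  where
  -- Two rooks in column `j` reflect to two values of `lookup p j`, which must coincide.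
  inj : colInjective p ≡ true
  inj = all-complete _ (cells n) λ { (i , j) → all-complete _ (allFin n) λ a → implies-complete λ both →
    let rooks = ∧-true {rookAt p i j} both in
    dec-true (a Fin.≟ i) (Maybe.just-injective (trans
      (sym (symmetric g a j (rookAt-sound p a j (proj₂ rooks)))) (symmetric g i j (rookAt-sound p i j (proj₁ rooks))))) }
  ins : inside F p ≡ true
  ins = all-complete _ (cells n) λ { (i , j) → implies-complete λ r → in-diagram g i j (rookAt-sound p i j r) }
  symm : offDiagSymmetric p ≡ true
  symm = all-complete _ (cells n) λ { (i , j) → implies-complete λ r →
    trans (cong ((i ==ᶠ j) ∨_) (rookAt-complete p j i (symmetric g i j (rookAt-sound p i j r)))) (Bool.∨-zeroʳ _) }

att : ∀ {n} → Diagram n → Placement n → ℕ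
att {n} F p = ∑[ i ∈ allFin n ] (∑[ j ∈ allFin n ] 𝟙 (F i j ∧ attacked p i j))

occupied : ∀ {n} → Placement n → Fin n → Bool
occupied p i = is-just (lookup p i)

numOffDiag≡ : ∀ {n} (p : Placement n) →
  numOffDiag p ≡ ∑[ i ∈ allFin n ] (∑[ j ∈ allFin n ] 𝟙 (rookAt p i j ∧ not (i ==ᶠ j)))
numOffDiag≡ {n} p = trans (count≡∑ _ (cells n)) (∑-cells (λ i j → 𝟙 (rookAt p i j ∧ not (i ==ᶠ j))))

numDiag≡ : ∀ {n} (p : Placement n) → numDiag p ≡ ∑[ i ∈ allFin n ] 𝟙 (rookAt p i i)
numDiag≡ {n} p = count≡∑ _ (allFin n)

∑-row : ∀ {n} (p : Placement n) i → ∑[ j ∈ allFin n ] 𝟙 (rookAt p i j) ≡ 𝟙 (occupied p i)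
∑-row {n} p i with lookup p i
... | nothing = ∑-zero (allFin n)
... | just b  = trans (∑-cong (λ j → cong 𝟙 (does-⇔ (mk⇔ sym sym) (b Fin.≟ j) (j Fin.≟ b))) (allFin n))
  (Enum.once (Enum-Fin n) b)

-- Rooks are counted by rows, each row holding at most one. By symmetry the occupied rows are also
-- the occupied columns, which is how this number reaches the first row.
numOffDiag+numDiag : ∀ {n} (p : Placement n) → numOffDiag p + numDiag p ≡ ∑[ i ∈ allFin n ] 𝟙 (occupied p i)
numOffDiag+numDiag {n} p = begin
  numOffDiag p + numDiag p
    ≡⟨ cong₂ _+_ (numOffDiag≡ p) (numDiag≡ p) ⟩
  (∑[ i ∈ allFin n ] (∑[ j ∈ allFin n ] 𝟙 (rookAt p i j ∧ not (i ==ᶠ j)))) + (∑[ i ∈ allFin n ] 𝟙 (rookAt p i i))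
    ≡⟨ sym (∑-+ _ _ (allFin n)) ⟩
  ∑[ i ∈ allFin n ] ((∑[ j ∈ allFin n ] 𝟙 (rookAt p i j ∧ not (i ==ᶠ j))) + 𝟙 (rookAt p i i))
    ≡⟨ ∑-cong row (allFin n) ⟩
  ∑[ i ∈ allFin n ] 𝟙 (occupied p i) ∎
  where
  open ≡-Reasoning
  row : ∀ i → (∑[ j ∈ allFin n ] 𝟙 (rookAt p i j ∧ not (i ==ᶠ j))) + 𝟙 (rookAt p i i) ≡ 𝟙 (occupied p i)
  row i = begin
    (∑[ j ∈ allFin n ] 𝟙 (rookAt p i j ∧ not (i ==ᶠ j))) + 𝟙 (rookAt p i i)
      ≡⟨ cong (off +_) (sym (∑-point (Enum-Fin n) i (λ j → 𝟙 (rookAt p i j)))) ⟩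
    off + (∑[ j ∈ allFin n ] (𝟙 (does (j Fin.≟ i)) * 𝟙 (rookAt p i j)))
      ≡⟨ cong (off +_) (∑-cong (λ j → trans (sym (𝟙-∧ (does (j Fin.≟ i)) (rookAt p i j))) (cong 𝟙 (trans
          (Bool.∧-comm (does (j Fin.≟ i)) (rookAt p i j))
           (cong (rookAt p i j ∧_) (does-⇔ (mk⇔ sym sym) (j Fin.≟ i) (i Fin.≟ j)))))) (allFin n)) ⟩
    off + (∑[ j ∈ allFin n ] 𝟙 (rookAt p i j ∧ (i ==ᶠ j)))
      ≡⟨ +-comm off _ ⟩
    (∑[ j ∈ allFin n ] 𝟙 (rookAt p i j ∧ (i ==ᶠ j))) + off
      ≡⟨ sym (∑-+ _ _ (allFin n)) ⟩
    ∑[ j ∈ allFin n ] (𝟙 (rookAt p i j ∧ (i ==ᶠ j)) + 𝟙 (rookAt p i j ∧ not (i ==ᶠ j)))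
      ≡⟨ ∑-cong (λ j → sym (𝟙-split (rookAt p i j) (i ==ᶠ j))) (allFin n) ⟩
    ∑[ j ∈ allFin n ] 𝟙 (rookAt p i j)
      ≡⟨ ∑-row p i ⟩
    𝟙 (occupied p i) ∎
    where off = ∑[ j ∈ allFin n ] 𝟙 (rookAt p i j ∧ not (i ==ᶠ j))

Enum-Placement : ∀ n → Enum (Placement n)
Enum-Placement n = Enum-Vec (Enum-Maybe (Enum-Fin n)) n

rookSum : ∀ {n} → Diagram n → (ℕ → ℕ → ℕ → ℕ) → ℕ
rookSum {n} F φ = ∑[ p ∈ allPlacements n ] (𝟙 (good F p) * φ (numOffDiag p) (numDiag p) (att F p))

rookSum-empty : ∀ {n} (F : Diagram n) → Empty F → ∀ φ → rookSum F φ ≡ φ 0 0 0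
rookSum-empty {n} F F≡∅ φ = begin
  rookSum F φ
    ≡⟨ ∑-cong (λ p → cong (λ b → 𝟙 b * φ (numOffDiag p) (numDiag p) (att F p)) (bool-ext (to p) (from p))) (allPlacements n) ⟩
  ∑[ p ∈ allPlacements n ] (𝟙 (does (p ≟ᴾ O)) * φ (numOffDiag p) (numDiag p) (att F p))
    ≡⟨ ∑-point (Enum-Placement n) O _ ⟩
  φ (numOffDiag O) (numDiag O) (att F O)
    ≡⟨ cong₂ (λ a b → φ a b (att F O)) (m+n≡0⇒m≡0 _ none) (m+n≡0⇒n≡0 (numOffDiag O) none) ⟩
  φ 0 0 (att F O)
    ≡⟨ cong (φ 0 0) (trans (∑-cong (λ i → trans (∑-cong (λ j → cong (λ b → 𝟙 (b ∧ attacked O i j))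
        (F≡∅ i j)) (allFin n)) (∑-zero (allFin n))) (allFin n)) (∑-zero (allFin n))) ⟩
  φ 0 0 0 ∎
  where
  open ≡-Reasoning
  open Enum (Enum-Placement n) using () renaming (_≟_ to _≟ᴾ_)
  O : Placement n
  O = Vec.replicate n nothing
  O-nothing : ∀ i → lookup O i ≡ nothing
  O-nothing i = Vec.lookup-replicate i nothing
  none : numOffDiag O + numDiag O ≡ 0
  none = trans (numOffDiag+numDiag O) (trans (∑-cong (λ i → cong (𝟙 ∘ is-just) (O-nothing i)) (allFin n)) (∑-zero (allFin n)))
  to : ∀ p → good F p ≡ true → does (p ≟ᴾ O) ≡ true
  to p eq = dec-true (p ≟ᴾ O) (lookup-ext _ _ λ i → trans (no-rook i) (sym (O-nothing i)))
    where
    no-rook : ∀ i → lookup p i ≡ nothing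
    no-rook i with lookup p i in pi
    ... | nothing = refl
    ... | just j with trans (sym (F≡∅ i j)) (in-diagram (good-sound F p eq) i j pi)
    ...   | ()
  from : ∀ p → does (p ≟ᴾ O) ≡ true → good F p ≡ true
  from p eq with does≡true (p ≟ᴾ O) eq
  ... | refl = good-complete F O record
    { in-diagram = λ i j e → ⊥-elim (absurd i e) ; symmetric = λ i j e → ⊥-elim (absurd i e) }
    where
    absurd : ∀ i {j} → ¬ (lookup O i ≡ just j)
    absurd i e with trans (sym (O-nothing i)) e
    ... | ()

-- Adding and removing the first row and column of a placement

_≟ᵐ_ : ∀ {n} (x y : Maybe (Fin n)) → Dec (x ≡ y)
_≟ᵐ_ = Maybe.≡-dec Fin._≟_

-- x is the content of the first row; by symmetry a rook there in column suc b forces one in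
-- the first column of row suc b.
shifted : ∀ {n} → Maybe (Fin (suc n)) → Placement n → Fin n → Maybe (Fin (suc n))
shifted x p i = if does (x ≟ᵐ just (suc i)) then just zero else Maybe.map suc (lookup p i)

attach : ∀ {n} → Maybe (Fin (suc n)) → Placement n → Placement (suc n)
attach x p = x ∷ Vec.tabulate (shifted x p)

lower : ∀ {n} → Maybe (Fin (suc n)) → Maybe (Fin n)
lower (just (suc j)) = just j
lower (just zero)    = nothing
lower nothing        = nothing

detach : ∀ {n} → Placement (suc n) → Maybe (Fin (suc n)) × Placement n
detach (x ∷ p) = x , Vec.map lower p

-- A rook in column `suc b` of the first row brings its mirror image into row `suc b`, so row `b` of
-- the inner placement has to be empty.
allowed : ∀ {n} → Diagram (suc n) → Maybe (Fin (suc n)) → Placement n → Bool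
allowed F nothing        p = true
allowed F (just zero)    p = F zero zero
allowed F (just (suc b)) p = F zero (suc b) ∧ is-nothing (lookup p b)

-- The part of `allowed` that does not involve the diagram. It says that `attach` overwrites no
-- rook, and it is equivalent to `detach` undoing `attach`.
Compatible : ∀ {n} → Maybe (Fin (suc n)) → Placement n → Set
Compatible x p = ∀ b → x ≡ just (suc b) → lookup p b ≡ nothing

module _ {n} (x : Maybe (Fin (suc n))) (p : Placement n) where

  lookup-attach : ∀ i → lookup (attach x p) (suc i) ≡ shifted x p i
  lookup-attach i = Vec.lookup∘tabulate (shifted x p) i

  attach-first-column : ∀ i → lookup (attach x p) (suc i) ≡ just zero → x ≡ just (suc i)
  attach-first-column i eq with x ≟ᵐ just (suc i) | trans (sym (lookup-attach i)) eq
  ... | yes x≡ | _ = x≡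
  ... | no _   | e with lookup p i | e
  ...   | just _  | ()
  ...   | nothing | ()

  attach-first-column⁻ : ∀ i → x ≡ just (suc i) → lookup (attach x p) (suc i) ≡ just zero
  attach-first-column⁻ i x≡ = trans (lookup-attach i)
    (cong (λ b → if b then just zero else Maybe.map suc (lookup p i)) (dec-true (x ≟ᵐ just (suc i)) x≡))

  attach-inner : ∀ i j → lookup (attach x p) (suc i) ≡ just (suc j) → lookup p i ≡ just j
  attach-inner i j eq with x ≟ᵐ just (suc i) | trans (sym (lookup-attach i)) eq
  ... | yes _ | ()
  ... | no _  | e with lookup p i | e
  ...   | just .j | refl = refl

  module _ (comp : Compatible x p) where

    attach-inner⁻ : ∀ i j → lookup p i ≡ just j → lookup (attach x p) (suc i) ≡ just (suc j)
    attach-inner⁻ i j eq with lookup-attach i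
    ... | la with x ≟ᵐ just (suc i)
    ...   | no _   = trans la (cong (Maybe.map suc) eq)
    ...   | yes x≡ with trans (sym (comp i x≡)) eq
    ...     | ()

    detach-attach : detach (attach x p) ≡ (x , p)
    detach-attach = cong (x ,_) (lookup-ext _ _ λ i → trans (Vec.lookup-map i lower (Vec.tabulate
        (shifted x p))) (trans (cong lower (lookup-attach i)) (at i)))
      where
      at : ∀ i → lower (shifted x p i) ≡ lookup p i
      at i with x ≟ᵐ just (suc i)
      ... | yes x≡ = sym (comp i x≡)
      ... | no _ with lookup p i
      ...   | just _  = refl
      ...   | nothing = refl

  detach-attach⁻ : detach (attach x p) ≡ (x , p) → Compatible x p
  detach-attach⁻ eq b x≡ = begin
    lookup p b                                ≡⟨ cong (λ y → lookup (proj₂ y) b) (sym eq) ⟩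
    lookup (proj₂ (detach (attach x p))) b    ≡⟨ Vec.lookup-map b lower (Vec.tabulate (shifted x p)) ⟩
    lower (lookup (attach x p) (suc b))       ≡⟨ cong lower (attach-first-column⁻ b x≡) ⟩
    nothing ∎
    where open ≡-Reasoning

-- `detach` erases rooks in the first column, and `attach` rebuilds them from the first row; for a
-- symmetric placement the two agree.
attach-detach : ∀ {n} (F : Diagram (suc n)) P → Good F P → attach (proj₁ (detach P)) (proj₂ (detach P)) ≡ P
attach-detach F (x ∷ T) g = cong (x ∷_) (lookup-ext _ _ λ i →
  trans (Vec.lookup∘tabulate _ i) (trans (cong (λ y → if does (x ≟ᵐ just
      (suc i)) then just zero else Maybe.map suc y) (Vec.lookup-map i lower T)) (at i)))
  where
  at : ∀ i → (if does (x ≟ᵐ just (suc i)) then just zero else Maybe.map suc (lower (lookup T i))) ≡ lookup T i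
  at i with x ≟ᵐ just (suc i)
  ... | yes x≡ = sym (symmetric g zero (suc i) x≡)
  ... | no x≢ with lookup T i in Ti
  ...   | nothing       = refl
  ...   | just (suc j)  = refl
  ...   | just zero     = ⊥-elim (x≢ (symmetric g (suc i) zero Ti))

allowed-compatible : ∀ {n} (F : Diagram (suc n)) x p → allowed F x p ≡ true → Compatible x p
allowed-compatible F (just (suc b)) p eq .b refl with lookup p b | ∧-true {F zero (suc b)} eq
... | nothing | _ = refl

allowed-diagram : ∀ {n} (F : Diagram (suc n)) x p → allowed F x p ≡ true → ∀ j → x ≡ just j → F zero j ≡ true
allowed-diagram F (just zero)    p eq .zero    refl = eq
allowed-diagram F (just (suc b)) p eq .(suc b) refl = proj₁ (∧-true eq)

allowed-complete : ∀ {n} (F : Diagram (suc n)) x p → Compatible x p → (∀ j → x ≡ just j → F zero j ≡ true) → allowed F x p ≡ true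
allowed-complete F nothing        p c f = refl
allowed-complete F (just zero)    p c f = f zero refl
allowed-complete F (just (suc b)) p c f = cong₂ _∧_ (f (suc b) refl) (cong is-nothing (c b refl))

-- The value at `just zero` is `false` because a corner rook reaches no further cell of the first
-- row.
below : ∀ {n} → Maybe (Fin (suc n)) → Fin n → Bool
below (just (suc b)) j = j ≤ᵇᶠ b
below (just zero)    j = false
below nothing        j = false

below-sound : ∀ {n} (x : Maybe (Fin (suc n))) j → below x j ≡ true → ∃ λ b → x ≡ just (suc b) × j Fin.≤ b
below-sound (just (suc b)) j eq = b , refl , does≡true (j Fin.≤? b) eq

below-complete : ∀ {n} {b j : Fin n} x → x ≡ just (suc b) → j Fin.≤ b → below x j ≡ true
below-complete {b = b} {j} _ refl j≤b = dec-true (j Fin.≤? b) j≤b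

occupied-complete : ∀ {n} (p : Placement n) i {j} → lookup p i ≡ just j → occupied p i ≡ true
occupied-complete p i eq = cong is-just eq

occupied-sound : ∀ {n} (p : Placement n) i → occupied p i ≡ true → ∃ λ j → lookup p i ≡ just j
occupied-sound p i eq with lookup p i
... | just j = j , refl

-- The cells attacked by a rook in the first row only, among those above the diagonal.
fresh : ∀ {n} → Maybe (Fin (suc n)) → Placement n → ℕ
fresh {n} x p = ∑[ j ∈ allFin n ] 𝟙 (below x j ∧ is-nothing (lookup p j))

∑-first-row : ∀ {n} x (T : Vec (Maybe (Fin (suc n))) n) →
  ∑[ j ∈ allFin n ] 𝟙 (rookAt (x ∷ T) zero (suc j)) ≡ 𝟙 (is-just (lower x))
∑-first-row {n} nothing        T = ∑-zero (allFin n)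
∑-first-row {n} (just zero)    T = ∑-zero (allFin n)
∑-first-row {n} (just (suc b)) T =
  trans (∑-cong (λ j → cong 𝟙 (does-⇔ (mk⇔ sym sym) (b Fin.≟ j) (j Fin.≟ b))) (allFin n)) (Enum.once (Enum-Fin n) b)

-- Statistics of an extended placement

module _ {n} (F : Diagram (suc n)) (fer : IsFerrers F) (syF : IsSymmetricDiagram F) (corner : F zero zero ≡ true) where

  module _ (x : Maybe (Fin (suc n))) (p : Placement n) where

    good-attach⁻ : Compatible x p → Good F (attach x p) → allowed F x p ∧ good (inner F) p ≡ true
    good-attach⁻ comp g = cong₂ _∧_ (allowed-complete F x p comp (in-diagram g zero)) (good-complete (inner F) p record
      { in-diagram = λ i j e → in-diagram g (suc i) (suc j) (attach-inner⁻ x p comp i j e)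
      ; symmetric  = λ i j e → attach-inner x p j i (symmetric g (suc i) (suc j) (attach-inner⁻ x p comp i j e)) })

    good-attach : allowed F x p ≡ true → Good (inner F) p → Good F (attach x p)
    good-attach ok g = record { in-diagram = ins ; symmetric = symm }
      where
      comp = allowed-compatible F x p ok
      ins : ∀ i j → lookup (attach x p) i ≡ just j → F i j ≡ true
      ins zero    j       e = allowed-diagram F x p ok j e
      ins (suc i) zero    e = syF zero (suc i) (allowed-diagram F x p ok (suc i) (attach-first-column x p i e))
      ins (suc i) (suc j) e = in-diagram g i j (attach-inner x p i j e)
      symm : ∀ i j → lookup (attach x p) i ≡ just j → lookup (attach x p) j ≡ just i
      symm zero    zero    e = e
      symm zero    (suc j) e = attach-first-column⁻ x p j e
      symm (suc i) zero    e = attach-first-column x p i e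
      symm (suc i) (suc j) e = attach-inner⁻ x p comp j i (symmetric g i j (attach-inner x p i j e))

    module _ (ok : allowed F x p ≡ true) (g : Good (inner F) p) where
      private
        P = attach x p
        comp = allowed-compatible F x p ok

      rook-inner : ∀ i j → rookAt P (suc i) (suc j) ≡ rookAt p i j
      rook-inner i j = rookAt-ext P p (suc i) (suc j) i j (attach-inner x p i j) (attach-inner⁻ x p comp i j)

      F-flip : ∀ i → F (suc i) zero ≡ F zero (suc i)
      F-flip i = bool-ext (syF (suc i) zero) (syF zero (suc i))

      numDiag-attach : numDiag P ≡ 𝟙 (rookAt P zero zero) + numDiag p
      numDiag-attach = trans (numDiag≡ P) (trans (∑-allFin (λ i → 𝟙 (rookAt P i i)))
        (cong (𝟙 (rookAt P zero zero) +_) (trans (∑-cong (λ i → cong 𝟙 (rook-inner i i)) (allFin n)) (sym (numDiag≡ p)))))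

      first-column : ∀ i → rookAt P (suc i) zero ≡ rookAt P zero (suc i)
      first-column i = rookAt-ext P P (suc i) zero zero (suc i) (attach-first-column x p i) (attach-first-column⁻ x p i)

      numOffDiag-attach : numOffDiag P ≡ 2 * 𝟙 (is-just (lower x)) + numOffDiag p
      numOffDiag-attach = begin
        numOffDiag P
          ≡⟨ numOffDiag≡ P ⟩
        ∑[ i ∈ allFin (suc n) ] (∑[ j ∈ allFin (suc n) ] off i j)
          ≡⟨ trans (∑-cong (λ i → ∑-allFin (off i)) (allFin (suc n))) (∑-allFin (λ i → off i zero +
              (∑[ j ∈ allFin n ] off i (suc j)))) ⟩
        off zero zero + (∑[ j ∈ allFin n ] off zero (suc j)) + (∑[ i ∈ allFin n ] (off (suc i) zero +
            (∑[ j ∈ allFin n ] off (suc i) (suc j))))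
          ≡⟨ cong₂ _+_ (cong₂ _+_ (cong 𝟙 (Bool.∧-zeroʳ (rookAt P zero zero))) (trans (∑-cong (λ j → cong 𝟙
              (Bool.∧-identityʳ _)) (allFin n)) (∑-first-row x (Vec.tabulate (shifted x p)))))
               (trans (∑-+ _ _ (allFin n)) (cong₂ _+_ (trans (∑-cong (λ i → cong 𝟙 (trans
                   (Bool.∧-identityʳ _) (first-column i))) (allFin n)) (∑-first-row x (Vec.tabulate (shifted x p))))
                 (trans (∑-cong (λ i → ∑-cong (λ j → cong (λ b → 𝟙 (b ∧ not (i ==ᶠ j))) (rook-inner i j))
                     (allFin n)) (allFin n)) (sym (numOffDiag≡ p))))) ⟩
        e + (e + numOffDiag p)
          ≡⟨ solve 2 (λ e o → e :+ (e :+ o) := con 2 :* e :+ o) refl e (numOffDiag p) ⟩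
        2 * e + numOffDiag p ∎
        where
        open ≡-Reasoning
        open +-*-Solver
        e = 𝟙 (is-just (lower x))
        off : Fin (suc n) → Fin (suc n) → ℕ
        off i j = 𝟙 (rookAt P i j ∧ not (i ==ᶠ j))

      attacked-inner : ∀ i j → attacked P (suc i) (suc j) ≡ attacked p i j
      attacked-inner i j = bool-ext (attacked-complete p i j ∘ to ∘ attacked-sound P (suc i) (suc j))
        (attacked-complete P (suc i) (suc j) ∘ from ∘ attacked-sound p i j)
        where
        to : Attacked P (suc i) (suc j) → Attacked p i j
        to (inj₁ (suc a , s≤s i≤a , e)) = inj₁ (a , i≤a , attach-inner x p a j e)
        to (inj₂ (suc b , s≤s j≤b , e)) = inj₂ (b , j≤b , attach-inner x p i b e)
        from : Attacked p i j → Attacked P (suc i) (suc j)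
        from (inj₁ (a , i≤a , e)) = inj₁ (suc a , s≤s i≤a , attach-inner⁻ x p comp a j e)
        from (inj₂ (b , j≤b , e)) = inj₂ (suc b , s≤s j≤b , attach-inner⁻ x p comp i b e)

      attacked-corner : attacked P zero zero ≡ is-just x
      attacked-corner = bool-ext (to ∘ attacked-sound P zero zero) (from x refl)
        where
        to : Attacked P zero zero → is-just x ≡ true
        to (inj₁ (zero , _ , e))  = cong is-just e
        to (inj₁ (suc a , _ , e)) = cong is-just (attach-first-column x p a e)
        to (inj₂ (_ , _ , e))     = cong is-just e
        from : ∀ y → x ≡ y → is-just y ≡ true → attacked P zero zero ≡ true
        from (just b) e _ = attacked-complete P zero zero (inj₂ (b , z≤n , e))

      -- A cell of the first row is attacked either from a rook lower in its column, which by
      -- symmetry exists exactly when row `j` is occupied, or from the first-row rook at or to the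
      -- right of it. The first column gives the same condition with the two causes reflected.
      hit : Fin n → Bool
      hit j = occupied p j ∨ below x j

      -- A rook in row `j` puts the first cell of that row into `F`, and reflection carries this
      -- cell to the first row. Hence all occupied columns, and all cells left of a first-row rook,
      -- lie in the arm.
      hit⇒arm : ∀ j → hit j ≡ true → F zero (suc j) ≡ true
      hit⇒arm j h with ∨-true (occupied p j) h
      ... | inj₁ o with occupied-sound p j o
      ...   | a , e = syF (suc j) zero (fer (suc j) (suc a) (suc j) zero (in-diagram g j a e) ≤-refl z≤n)
      hit⇒arm j h | inj₂ l with below-sound x j l
      ...   | b , x≡ , j≤b = fer zero (suc b) zero (suc j) (allowed-diagram F x p ok (suc b) x≡) z≤n (s≤s j≤b)

      attacked-row : ∀ j → attacked P zero (suc j) ≡ hit j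
      attacked-row j = bool-ext (to ∘ attacked-sound P zero (suc j)) from
        where
        left : occupied p j ≡ true → hit j ≡ true
        left e = cong (_∨ below x j) e
        right : below x j ≡ true → hit j ≡ true
        right e = trans (cong (occupied p j ∨_) e) (Bool.∨-zeroʳ _)
        to : Attacked P zero (suc j) → hit j ≡ true
        to (inj₁ (zero , _ , e))        = right (below-complete x e ≤-refl)
        to (inj₁ (suc a , _ , e))       = left (occupied-complete p j (symmetric g a j (attach-inner x p a j e)))
        to (inj₂ (suc b , s≤s j≤b , e)) = right (below-complete x e j≤b)
        from : hit j ≡ true → attacked P zero (suc j) ≡ true
        from h with ∨-true (occupied p j) h
        ... | inj₁ o with occupied-sound p j o
        ...   | a , e = attacked-complete P zero (suc j) (inj₁ (suc a , z≤n , attach-inner⁻ x p comp a j (symmetric g j a e)))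
        from h | inj₂ l with below-sound x j l
        ...   | b , x≡ , j≤b = attacked-complete P zero (suc j) (inj₂ (suc b , s≤s j≤b , x≡))

      attacked-column : ∀ i → attacked P (suc i) zero ≡ hit i
      attacked-column i = bool-ext (to ∘ attacked-sound P (suc i) zero) from
        where
        left : occupied p i ≡ true → hit i ≡ true
        left e = cong (_∨ below x i) e
        right : below x i ≡ true → hit i ≡ true
        right e = trans (cong (occupied p i ∨_) e) (Bool.∨-zeroʳ _)
        to : Attacked P (suc i) zero → hit i ≡ true
        to (inj₁ (suc a , s≤s i≤a , e)) = right (below-complete x (attach-first-column x p a e) i≤a)
        to (inj₂ (zero , _ , e))        = right (below-complete x (attach-first-column x p i e) ≤-refl)
        to (inj₂ (suc b , _ , e))       = left (occupied-complete p i (attach-inner x p i b e))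
        from : hit i ≡ true → attacked P (suc i) zero ≡ true
        from h with ∨-true (occupied p i) h
        ... | inj₁ o with occupied-sound p i o
        ...   | b , e = attacked-complete P (suc i) zero (inj₂ (suc b , z≤n , attach-inner⁻ x p comp i b e))
        from h | inj₂ l with below-sound x i l
        ...   | b , x≡ , i≤b = attacked-complete P (suc i) zero (inj₁ (suc b , s≤s i≤b , attach-first-column⁻ x p b x≡))

      ∑-hit : ∑[ j ∈ allFin n ] 𝟙 (F zero (suc j) ∧ hit j) ≡ numOffDiag p + numDiag p + fresh x p
      ∑-hit = trans (∑-cong term (allFin n)) (trans (∑-+ _ _ (allFin n)) (cong (_+ fresh x p) (sym (numOffDiag+numDiag p))))
        where
        split : ∀ j → 𝟙 (hit j) ≡ 𝟙 (occupied p j) + 𝟙 (below x j ∧ is-nothing (lookup p j))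
        split j with lookup p j | below x j
        ... | just _  | true  = refl
        ... | just _  | false = refl
        ... | nothing | true  = refl
        ... | nothing | false = refl
        term : ∀ j → 𝟙 (F zero (suc j) ∧ hit j) ≡ 𝟙 (occupied p j) + 𝟙 (below x j ∧ is-nothing (lookup p j))
        term j = trans (cong 𝟙 (bool-ext (proj₂ ∘ ∧-true {F zero (suc j)}) (λ h → cong₂ _∧_ (hit⇒arm j h) h))) (split j)

      -- The first row and the first column contribute equally, whereas the corner counts once and
      -- is attacked exactly when the first row holds a rook. Accumulated over the recursion, the
      -- corners are the attacked diagonal cells.
      att-attach : att F P ≡ att (inner F) p + 𝟙 (is-just x) + 2 * (numOffDiag p + numDiag p + fresh x p)
      att-attach = begin
        ∑[ i ∈ allFin (suc n) ] (∑[ j ∈ allFin (suc n) ] a i j)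
          ≡⟨ trans (∑-cong (λ i → ∑-allFin (a i)) (allFin (suc n))) (∑-allFin (λ i → a i zero +
              (∑[ j ∈ allFin n ] a i (suc j)))) ⟩
        a zero zero + (∑[ j ∈ allFin n ] a zero (suc j)) + (∑[ i ∈ allFin n ] (a (suc i) zero +
            (∑[ j ∈ allFin n ] a (suc i) (suc j))))
          ≡⟨ cong₂ _+_ (cong₂ _+_ (cong₂ (λ b c → 𝟙 (b ∧ c)) corner attacked-corner) (trans (∑-cong
              (λ j → cong (λ b → 𝟙 (F zero (suc j) ∧ b)) (attacked-row j)) (allFin n)) ∑-hit))
               (trans (∑-+ _ _ (allFin n)) (cong₂ _+_ (trans (∑-cong (λ i → cong₂ (λ b c → 𝟙 (b ∧ c))
                   (F-flip i) (attacked-column i)) (allFin n)) ∑-hit)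
                 (∑-cong (λ i → ∑-cong (λ j → cong (λ b → 𝟙 (F (suc i) (suc j) ∧ b)) (attacked-inner i j))
                     (allFin n)) (allFin n)))) ⟩
        𝟙 (is-just x) + s + (s + att (inner F) p)
          ≡⟨ solve 3 (λ e s a → e :+ s :+ (s :+ a) := a :+ e :+ con 2 :* s) refl (𝟙 (is-just x)) s (att (inner F) p) ⟩
        att (inner F) p + 𝟙 (is-just x) + 2 * s ∎
        where
        open ≡-Reasoning
        open +-*-Solver
        s = numOffDiag p + numDiag p + fresh x p
        a : Fin (suc n) → Fin (suc n) → ℕ
        a i j = 𝟙 (F i j ∧ attacked P i j)

-- The recursion for sums over symmetric placements

suc-≤ᵇᶠ : ∀ {n} (i j : Fin n) → (suc i ≤ᵇᶠ suc j) ≡ (i ≤ᵇᶠ j)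
suc-≤ᵇᶠ i j = does-⇔ (mk⇔ ℕ.s≤s⁻¹ s≤s) (suc i Fin.≤? suc j) (i Fin.≤? j)

-- The k-th element b of c is the one with k elements of c up to it.
∑-by-position : ∀ {n} (c : Fin n → Bool) (Φ : ℕ → ℕ) →
  ∑[ b ∈ allFin n ] (𝟙 (c b) * Φ (∑[ j ∈ allFin n ] 𝟙 ((j ≤ᵇᶠ b) ∧ c j))) ≡
  ∑[ k ∈ upTo (∑[ j ∈ allFin n ] 𝟙 (c j)) ] Φ (suc k)
∑-by-position {zero}  c Φ = refl
∑-by-position {suc n} c Φ = begin
  ∑[ b ∈ allFin (suc n) ] (𝟙 (c b) * Φ (position b))
    ≡⟨ ∑-allFin (λ b → 𝟙 (c b) * Φ (position b)) ⟩
  𝟙 (c zero) * Φ (position zero) + (∑[ b ∈ allFin n ] (𝟙 (c (suc b)) * Φ (position (suc b))))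
    ≡⟨ cong₂ _+_ (cong (λ k → 𝟙 (c zero) * Φ k) position-zero)
         -- A marked first element shifts every later position by one, so the induction hypothesis
         -- is applied to the shifted `Φ`.
         (trans (∑-cong (λ b → cong (λ k → 𝟙 (c (suc b)) * Φ k) (position-suc b)) (allFin n)) (∑-by-position
             (c ∘ suc) (Φ ∘ (𝟙 (c zero) +_)))) ⟩
  𝟙 (c zero) * Φ (𝟙 (c zero)) + (∑[ k ∈ upTo total ] Φ (𝟙 (c zero) + suc k))
    ≡⟨ first ⟩
  ∑[ k ∈ upTo (𝟙 (c zero) + total) ] Φ (suc k)
    ≡⟨ cong (λ m → ∑ (upTo m) (Φ ∘ suc)) (sym (∑-allFin (𝟙 ∘ c))) ⟩
  ∑[ k ∈ upTo (∑[ j ∈ allFin (suc n) ] 𝟙 (c j)) ] Φ (suc k) ∎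
  where
  open ≡-Reasoning
  position : Fin (suc n) → ℕ
  position b = ∑[ j ∈ allFin (suc n) ] 𝟙 ((j ≤ᵇᶠ b) ∧ c j)
  total = ∑[ j ∈ allFin n ] 𝟙 (c (suc j))
  position-zero : position zero ≡ 𝟙 (c zero)
  position-zero = trans (∑-allFin (λ j → 𝟙 ((j ≤ᵇᶠ zero) ∧ c j))) (trans (cong (𝟙 (c zero) +_) (∑-zero
      (allFin n))) (+-identityʳ _))
  position-suc : ∀ b → position (suc b) ≡ 𝟙 (c zero) + (∑[ j ∈ allFin n ] 𝟙 ((j ≤ᵇᶠ b) ∧ c (suc j)))
  position-suc b = trans (∑-allFin (λ j → 𝟙 ((j ≤ᵇᶠ suc b) ∧ c j)))
    (cong (𝟙 (c zero) +_) (∑-cong (λ j → cong (λ z → 𝟙 (z ∧ c (suc j))) (suc-≤ᵇᶠ j b)) (allFin n)))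
  first : 𝟙 (c zero) * Φ (𝟙 (c zero)) + (∑[ k ∈ upTo total ] Φ (𝟙 (c zero) + suc k)) ≡ ∑[ k ∈ upTo (𝟙
      (c zero) + total) ] Φ (suc k)
  first with c zero
  ... | true  = trans (cong (_+ (∑[ k ∈ upTo total ] Φ (suc (suc k)))) (+-identityʳ (Φ 1))) (sym (∑-upTo total (Φ ∘ suc)))
  ... | false = refl

-- The counterpart of `bordered` for placements: empty first row, corner rook, pair in the free
-- column number `suc k`. The factor 2 stands for row and column, and each `suc` around the last
-- argument for the corner.
attached : ℕ → (ℕ → ℕ → ℕ → ℕ) → ℕ → ℕ → ℕ → ℕ
attached c φ o d a = φ o d (a + 2 * r) + (φ o (suc d) (suc (a + 2 * r)) +
  (∑[ k ∈ upTo (c ∸ r) ] φ (2 + o) d (suc (a + 2 * (r + suc k)))))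
  where r = o + d

rookSum-step : ∀ {n} (F : Diagram (suc n)) → IsFerrers F → IsSymmetricDiagram F → F zero zero ≡ true →
  ∀ φ → rookSum F φ ≡ rookSum (inner F) (attached (arm F) φ)
rookSum-step {n} F fer syF corner φ = begin
  rookSum F φ
    ≡⟨ reindex (Enum-Placement (suc n)) EY e detach f supp ⟩
  ∑[ y ∈ list EY ] (𝟙 (does (detach (e y) ≟ʸ y)) * f (e y))
    ≡⟨ trans (∑-pairs xs (allPlacements n) _) (∑-swap (λ x p → 𝟙 (does (detach (e (x , p)) ≟ʸ (x , p))) * f
        (e (x , p))) xs (allPlacements n)) ⟩
  ∑[ p ∈ allPlacements n ] (∑[ x ∈ xs ] (𝟙 (does (detach (attach x p) ≟ʸ (x , p))) * f (attach x p)))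
    ≡⟨ ∑-cong (λ p → trans (∑-cong (term p) xs) (∑-*ˡ (𝟙 (good (inner F) p)) (λ x → 𝟙
        (allowed F x p) * value x p) xs)) (allPlacements n) ⟩
  ∑[ p ∈ allPlacements n ] (𝟙 (good (inner F) p) * (∑[ x ∈ xs ] (𝟙 (allowed F x p) * value x p)))
    ≡⟨ ∑-cong rows (allPlacements n) ⟩
  rookSum (inner F) (attached (arm F) φ) ∎
  where
  open ≡-Reasoning
  EM = Enum-Maybe (Enum-Fin (suc n))
  EY = Enum-× EM (Enum-Placement n)
  open Enum EY using () renaming (_≟_ to _≟ʸ_)
  xs = list EM
  e : Maybe (Fin (suc n)) × Placement n → Placement (suc n)
  e (x , p) = attach x p
  f : Placement (suc n) → ℕ
  f P = 𝟙 (good F P) * φ (numOffDiag P) (numDiag P) (att F P)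
  value : Maybe (Fin (suc n)) → Placement n → ℕ
  value x p = φ (2 * 𝟙 (is-just (lower x)) + numOffDiag p) (𝟙 (rookAt (attach x p) zero zero) + numDiag p)
    (att (inner F) p + 𝟙 (is-just x) + 2 * (numOffDiag p + numDiag p + fresh x p))
  supp : ∀ P → ¬ (f P ≡ 0) → e (detach P) ≡ P
  supp P f≢0 with good F P in eq
  ... | false = ⊥-elim (f≢0 refl)
  ... | true  = attach-detach F P (good-sound F P eq)

  false≢true : ¬ (false ≡ true)
  false≢true ()
  -- Either `attach` overwrites a rook, and the first factor is 0, or nothing is lost, and then a
  -- good result would make `x` and `p` admissible after all.
  excluded : ∀ p x → ¬ (allowed F x p ∧ good (inner F) p ≡ true) → 𝟙 (does (detach (attach x p) ≟ʸ (x , p))) * f (attach x p) ≡ 0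
  excluded p x bad with detach (attach x p) ≟ʸ (x , p) | good F (attach x p) in gd
  ... | no _   | _     = refl
  ... | yes _  | false = refl
  ... | yes eq | true  = ⊥-elim (bad (good-attach⁻ F fer syF corner x p (detach-attach⁻ x p eq) (good-sound F (attach x p) gd)))
  term : ∀ p x → 𝟙 (does (detach (attach x p) ≟ʸ (x , p))) * f (attach x p) ≡ 𝟙 (good (inner F) p) * (𝟙
      (allowed F x p) * value x p)
  term p x with allowed F x p in ok | good (inner F) p in gd
  ... | true  | true  = begin
    𝟙 (does (detach (attach x p) ≟ʸ (x , p))) * f (attach x p)
      ≡⟨ cong₂ (λ b c → 𝟙 b * (𝟙 c * v)) (dec-true (detach (attach x p) ≟ʸ (x , p)) (detach-attach x p
          (allowed-compatible F x p ok)))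
           (good-complete F (attach x p) (good-attach F fer syF corner x p ok g)) ⟩
    1 * (1 * v)
      ≡⟨ cong (λ z → 1 * (1 * z)) stats ⟩
    1 * (1 * value x p) ∎
    where
    g = good-sound (inner F) p gd
    v = φ (numOffDiag (attach x p)) (numDiag (attach x p)) (att F (attach x p))
    stats : v ≡ value x p
    stats = trans (cong₂ (λ o d → φ o d (att F (attach x p))) (numOffDiag-attach F fer syF corner x p ok g)
        (numDiag-attach F fer syF corner x p ok g))
      (cong (φ (2 * 𝟙 (is-just (lower x)) + numOffDiag p) (𝟙 (rookAt (attach x p) zero zero) + numDiag p))
          (att-attach F fer syF corner x p ok g))
  ... | true  | false = excluded p x λ both → false≢true (trans (sym gd) (proj₂ (∧-true {allowed F x p} both)))
  ... | false | g     = trans (excluded p x λ both → false≢true (trans (sym ok) (proj₁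
      (∧-true {allowed F x p} both)))) (sym (*-zeroʳ (𝟙 g)))

  rows : ∀ p → 𝟙 (good (inner F) p) * (∑[ x ∈ xs ] (𝟙 (allowed F x p) * value x p)) ≡ 𝟙 (good
      (inner F) p) * attached (arm F) φ (numOffDiag p) (numDiag p) (att (inner F) p)
  rows p with good (inner F) p in gd
  ... | false = refl
  ... | true  = cong (1 *_) (begin
    ∑[ x ∈ xs ] G x
      ≡⟨ cong (G nothing +_) (trans (∑-map just G (allFin (suc n))) (∑-allFin (G ∘ just))) ⟩
    G nothing + (G (just zero) + (∑[ b ∈ allFin n ] G (just (suc b))))
      ≡⟨ cong₂ _+_ at-nothing (cong₂ _+_ at-zero (trans (∑-cong at-suc (allFin n)) (trans
          (∑-by-position c Φ) (cong (λ m → ∑ (upTo m) (Φ ∘ suc)) available)))) ⟩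
    attached (arm F) φ o d a ∎)
    where
    g = good-sound (inner F) p gd
    o = numOffDiag p
    d = numDiag p
    a = att (inner F) p
    r = o + d
    G : Maybe (Fin (suc n)) → ℕ
    G x = 𝟙 (allowed F x p) * value x p
    c : Fin n → Bool
    c b = F zero (suc b) ∧ is-nothing (lookup p b)
    Φ : ℕ → ℕ
    Φ k = φ (2 + o) d (suc (a + 2 * (r + k)))
    no-fresh : ∀ e → a + e + 2 * (r + (∑[ j ∈ allFin n ] 0)) ≡ e + (a + 2 * r)
    no-fresh e = trans (cong (λ s → a + e + 2 * (r + s)) (∑-zero (allFin n)))
      (+-*-Solver.solve 3 (λ a e r → a :+ e :+ con 2 :* (r :+ con 0) := e :+ (a :+ con 2 :* r)) refl a e r)
      where open +-*-Solver
    at-nothing : G nothing ≡ φ o d (a + 2 * r)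
    at-nothing = trans (*-identityˡ _) (cong (φ o d) (no-fresh 0))
    at-zero : G (just zero) ≡ φ o (suc d) (suc (a + 2 * r))
    at-zero = trans (cong (λ b → 𝟙 b * value (just zero) p) corner) (trans (*-identityˡ _) (cong (φ o (suc d)) (no-fresh 1)))
    at-suc : ∀ b → G (just (suc b)) ≡ 𝟙 (c b) * Φ (∑[ j ∈ allFin n ] 𝟙 ((j ≤ᵇᶠ b) ∧ c j))
    at-suc b with F zero (suc b) in Fb
    ... | false = refl
    ... | true  = cong (𝟙 (is-nothing (lookup p b)) *_) (cong (φ (2 + o) d) (trans
        (cong (λ s → a + 1 + 2 * (r + s)) (∑-cong (λ j → cong 𝟙 (same j)) (allFin n)))
        (cong (_+ 2 * (r + (∑[ j ∈ allFin n ] 𝟙 ((j ≤ᵇᶠ b) ∧ c j)))) (+-comm a 1))))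
      where
      -- Every column up to `b` lies in the arm, since column `suc b` of the first row does. Fresh
      -- columns are therefore the free columns up to `b`, and their number is the position of `b`.
      same : ∀ j → (j ≤ᵇᶠ b) ∧ is-nothing (lookup p j) ≡ (j ≤ᵇᶠ b) ∧ c j
      same j with j ≤ᵇᶠ b in le
      ... | false = refl
      ... | true  = cong (_∧ is-nothing (lookup p j))
        (sym (fer zero (suc b) zero (suc j) Fb z≤n (s≤s (does≡true (j Fin.≤? b) le))))
    -- All occupied columns lie in the arm, so they and the free ones partition it; the truncated
    -- subtraction is exact.
    available : ∑[ j ∈ allFin n ] 𝟙 (c j) ≡ arm F ∸ r
    available = begin
      s               ≡⟨ sym (m+n∸m≡n r s) ⟩
      r + s ∸ r       ≡⟨ cong (λ z → z + s ∸ r) (numOffDiag+numDiag p) ⟩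
      (∑[ j ∈ allFin n ] 𝟙 (occupied p j)) + s ∸ r
        ≡⟨ cong (_∸ r) (sym (∑-+ _ _ (allFin n))) ⟩
      (∑[ j ∈ allFin n ] (𝟙 (occupied p j) + 𝟙 (c j))) ∸ r
        ≡⟨ cong (_∸ r) (∑-cong cell (allFin n)) ⟩
      arm F ∸ r ∎
      where
      s = ∑[ j ∈ allFin n ] 𝟙 (c j)
      cell : ∀ j → 𝟙 (occupied p j) + 𝟙 (c j) ≡ 𝟙 (F zero (suc j))
      cell j with lookup p j in pj
      ... | nothing = cong 𝟙 (Bool.∧-identityʳ (F zero (suc j)))
      ... | just b  rewrite syF (suc j) zero (fer (suc j) (suc b) (suc j) zero (in-diagram g j b pj) ≤-refl z≤n) = refl

-- Of the attacked cells, `h` lie above the diagonal and `h` below. On the diagonal each rook there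
-- attacks its own cell, and each pair attacks one cell, at the smaller of its two indices; this
-- gives `t + d`.
value : (ℕ → ℕ → ℕ → ℕ) → Type → ℕ
value φ (t , d , h) = φ (2 * t) d (2 * h + t + d)

value-extend : ∀ c φ τ → ∑ (extend c τ) (value φ) ≡ value (attached c φ) τ
value-extend c φ (t , d , h) = cong₂ _+_ (cong (φ (2 * t) d) skip) (cong₂ _+_ (cong (φ (2 * t) (suc d)) diag)
  (trans (∑-map _ (value φ) (upTo (c ∸ r))) (∑-cong (λ k → cong₂ (λ o a → φ o d a) (*-suc 2 t) (pair k)) (upTo (c ∸ r)))))
  where
  open +-*-Solver
  r = 2 * t + d
  skip : 2 * (h + r) + t + d ≡ 2 * h + t + d + 2 * r
  skip = solve 4 (λ h r t d → con 2 :* (h :+ r) :+ t :+ d := con 2 :* h :+ t :+ d :+ con 2 :* r) refl h r t d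
  diag : 2 * (h + r) + t + suc d ≡ suc (2 * h + t + d + 2 * r)
  diag = solve 4 (λ h r t d → con 2 :* (h :+ r) :+ t :+ (con 1 :+ d) := con 1 :+
      (con 2 :* h :+ t :+ d :+ con 2 :* r)) refl h r t d
  pair : ∀ k → 2 * (h + r + suc k) + suc t + d ≡ suc (2 * h + t + d + 2 * (r + suc k))
  pair k = solve 5 (λ h r t d k → con 2 :* (h :+ r :+ k) :+ (con 1 :+ t) :+ d := con 1 :+
      (con 2 :* h :+ t :+ d :+ con 2 :* (r :+ k))) refl h r t d (suc k)

rookSum-types : ∀ {n} (F : Diagram n) → IsFerrers F → IsSymmetricDiagram F → ∀ φ →
  rookSum F φ ≡ ∑ (types F) (value φ)
rookSum-types {zero}  F fer syF φ = trans (rookSum-empty F (λ ()) φ) (sym (+-identityʳ _))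
rookSum-types {suc n} F fer syF φ = by-corner (F zero zero) refl
  where
  by-corner : ∀ b → F zero zero ≡ b → rookSum F φ ≡ ∑ (types F) (value φ)
  by-corner false corner = trans (rookSum-empty F (corner-false⇒empty F fer corner) φ)
    (sym (trans (cong (λ τs → ∑ τs (value φ)) (types-false F corner)) (+-identityʳ _)))
  by-corner true corner = begin
    rookSum F φ
      ≡⟨ rookSum-step F fer syF corner φ ⟩
    rookSum (inner F) (attached (arm F) φ)
      ≡⟨ rookSum-types (inner F) (inner-ferrers F fer) (inner-symmetric F syF) (attached (arm F) φ) ⟩
    ∑ (types (inner F)) (value (attached (arm F) φ))
      ≡⟨ ∑-cong (λ τ → sym (value-extend (arm F) φ τ)) (types (inner F)) ⟩
    ∑[ τ ∈ types (inner F) ] ∑ (extend (arm F) τ) (value φ)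
      ≡⟨ sym (∑-concatMap (extend (arm F)) (value φ) (types (inner F))) ⟩
    ∑ (concatMap (extend (arm F)) (types (inner F))) (value φ)
      ≡⟨ cong (λ τs → ∑ τs (value φ)) (sym (types-true F corner)) ⟩
    ∑ (types F) (value φ) ∎
    where open ≡-Reasoning

-- Powers of √q and the comparison of the two sides

-- π e is a component of √q ^ (2 * e) in ℕ[√q], that is q ^ e or 0.
contribution : ℕ → (ℕ → ℕ) → ℕ → Type → ℕ
contribution q π r (t , d , h) = 𝟙 ((2 * t + d) ≡ᵇ r) * ((q ∸ 1) ^ (t + d) * π (h + (2 * t + d)))

size∸inv : ∀ {n} (F : Diagram n) p → size F ∸ inv F p ≡ att F p
size∸inv {n} F p = begin
  size F ∸ inv F p
    ≡⟨ cong₂ _∸_ (trans (count≡∑ _ (cells n)) (trans (∑-cong (λ { (i , j) → 𝟙-split (F i j)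
        (attacked p i j) }) (cells n)) (∑-+ used free (cells n))))
         (count≡∑ _ (cells n)) ⟩
  ∑ (cells n) used + ∑ (cells n) free ∸ ∑ (cells n) free
    ≡⟨ m+n∸n≡m _ (∑ (cells n) free) ⟩
  ∑ (cells n) used
    ≡⟨ ∑-cells (λ i j → 𝟙 (F i j ∧ attacked p i j)) ⟩
  att F p ∎
  where
  open ≡-Reasoning
  used free : Fin n × Fin n → ℕ
  used c  = 𝟙 (F (proj₁ c) (proj₂ c) ∧ attacked p (proj₁ c) (proj₂ c))
  free c = 𝟙 (F (proj₁ c) (proj₂ c) ∧ not (attacked p (proj₁ c) (proj₂ c)))

sqrtPow-even : ∀ q e → sqrtPow q (2 * e) ≡ (q ^ e , 0)
sqrtPow-even q zero    = refl
sqrtPow-even q (suc e) = trans (cong (sqrtPow q) (*-suc 2 e))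
  (trans (cong (λ z → (q * proj₁ z , q * proj₂ z)) (sqrtPow-even q e)) (cong (q ^ suc e ,_) (*-zeroʳ q)))

-- `π` becomes `proj₁` and `proj₂` in turn: one computation yields both the integer part and the
-- vanishing of the coefficient of √q.
module _ (q : ℕ) (π : ℕ√ → ℕ) (π-0 : π (0 , 0) ≡ 0) (π-⊕ : ∀ x y → π (x ⊕ y) ≡ π x + π y) (π-⊙ : ∀ k x → π
    (k ⊙ x) ≡ k * π x) where

  π-Σ√ : {A : Set} (f : A → ℕ√) (xs : List A) → π (Σ√ (map f xs)) ≡ ∑ xs (π ∘ f)
  π-Σ√ f []       = π-0
  π-Σ√ f (x ∷ xs) = trans (π-⊕ (f x) _) (cong (π (f x) +_) (π-Σ√ f xs))

  -- Here `a` is the number of attacked cells, |F| - inv(F,P). The power of √q in the formula has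
  -- exponent `a - t - s`; the factor `q ^ r` adds `4 t + 2 s`, which gives `a + 3 t + s`.
  φ : ℕ → ℕ → ℕ → ℕ → ℕ → ℕ
  φ t s o d a = 𝟙 ((o ≡ᵇ 2 * t) ∧ (d ≡ᵇ s)) * π (sqrtPow q (a + 3 * t + s))

  isNARsym≡ : ∀ {n} (F : Diagram n) t s p → isNARsym F t s p ≡ good F p ∧ ((numOffDiag p ≡ᵇ 2 * t) ∧ (numDiag p ≡ᵇ s))
  isNARsym≡ F t s p = sym (trans (Bool.∧-assoc (colInjective p) _ _) (cong (colInjective p ∧_) (Bool.∧-assoc (inside F p) _ _)))

  π-Rsym : ∀ {n} (F : Diagram n) t s →
    π (Σ√ (map (λ e → sqrtPow q ((size F ∸ e) + 3 * t + s)) (RsymExps F t s))) ≡ rookSum F (φ t s)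
  π-Rsym {n} F t s = begin
    π (Σ√ (map (λ e → sqrtPow q ((size F ∸ e) + 3 * t + s)) (RsymExps F t s)))
      ≡⟨ π-Σ√ _ (RsymExps F t s) ⟩
    ∑[ e ∈ RsymExps F t s ] π (sqrtPow q ((size F ∸ e) + 3 * t + s))
      ≡⟨ trans (∑-map (inv F) _ (filter narsym? (allPlacements n))) (∑-filter narsym? _ (allPlacements n)) ⟩
    ∑[ p ∈ allPlacements n ] (𝟙 (does (isNARsym F t s p Data.Bool.≟ true)) * π (sqrtPow q ((size F ∸ inv F p) + 3 * t + s)))
      ≡⟨ ∑-cong term (allPlacements n) ⟩
    rookSum F (φ t s) ∎
    where
    open ≡-Reasoning
    narsym? : ∀ p → Dec (isNARsym F t s p ≡ true)
    narsym? p = isNARsym F t s p Data.Bool.≟ true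
    term : ∀ p → 𝟙 (does (isNARsym F t s p Data.Bool.≟ true)) * π (sqrtPow q ((size F ∸ inv F p) + 3 * t + s)) ≡
      𝟙 (good F p) * φ t s (numOffDiag p) (numDiag p) (att F p)
    term p = trans (cong₂ (λ b a → 𝟙 b * π (sqrtPow q (a + 3 * t + s))) (trans (does-≟-true _)
        (isNARsym≡ F t s p)) (size∸inv F p))
      (trans (cong (_* π (sqrtPow q (att F p + 3 * t + s))) (𝟙-∧ (good F p) _)) (*-assoc (𝟙 (good F p)) _ _))

  -- A type meets the test function of the pair `t`, `s` only when `t` is its own number of pairs
  -- and `s` its number of diagonal rooks, so at most one summand survives, and one does exactly
  -- when `2 t + d` equals `r`.
  ∑-pairs-of-type : ∀ r τ → ∑[ t ∈ upTo (suc r) ] (𝟙 (does (2 * t ℕ.≤? r)) * ((q ∸ 1) ^ (t +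
      (r ∸ 2 * t)) * value (φ t (r ∸ 2 * t)) τ)) ≡
    contribution q (λ e → π (q ^ e , 0)) r τ
  ∑-pairs-of-type r (t′ , d , h) with (2 * t′ + d) ℕ.≟ r
  ... | no ≢r = trans (∑-cong vanish (upTo (suc r))) (trans (∑-zero (upTo (suc r))) (cong (λ b → 𝟙 b *
      ((q ∸ 1) ^ (t′ + d) * π (q ^ (h + (2 * t′ + d)) , 0))) (sym (dec-false ((2 * t′ + d) ℕ.≟ r) ≢r))))
    where
    no-weight : ∀ t → 1 * ((q ∸ 1) ^ (t + (r ∸ 2 * t)) * 0) ≡ 0
    no-weight t = trans (*-identityˡ ((q ∸ 1) ^ (t + (r ∸ 2 * t)) * 0)) (*-zeroʳ ((q ∸ 1) ^ (t + (r ∸ 2 * t))))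
    vanish : ∀ t → 𝟙 (does (2 * t ℕ.≤? r)) * ((q ∸ 1) ^ (t + (r ∸ 2 * t)) * value (φ t (r ∸ 2 * t)) (t′ , d , h)) ≡ 0
    vanish t with does (2 * t ℕ.≤? r) in le | 2 * t′ ≡ᵇ 2 * t in eqᵗ | d ≡ᵇ r ∸ 2 * t in eqᵈ
    ... | false | _     | _     = refl
    ... | true  | false | _     = no-weight t
    ... | true  | true  | false = no-weight t
    ... | true  | true  | true  = ⊥-elim (≢r (trans
      (cong₂ _+_ (does≡true (2 * t′ ℕ.≟ 2 * t) eqᵗ) (does≡true (d ℕ.≟ r ∸ 2 * t) eqᵈ))
      (m+[n∸m]≡n (does≡true (2 * t ℕ.≤? r) le))))
  ... | yes refl = begin
    ∑[ t ∈ upTo (suc r) ] (𝟙 (does (2 * t ℕ.≤? r)) * ((q ∸ 1) ^ (t + (r ∸ 2 * t)) * value (φ t (r ∸ 2 * t)) (t′ , d , h)))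
      ≡⟨ ∑-cong single (upTo (suc r)) ⟩
    ∑[ t ∈ upTo (suc r) ] (𝟙 (does (t ℕ.≟ t′)) * X)
      ≡⟨ ∑-*ʳ X (λ t → 𝟙 (does (t ℕ.≟ t′))) (upTo (suc r)) ⟩
    (∑[ t ∈ upTo (suc r) ] 𝟙 (does (t ℕ.≟ t′))) * X
      -- The index `t′` is in range because `t′ ≤ 2 * t′ ≤ r`.
      ≡⟨ cong (_* X) (unique⇒once ℕ._≟_ (upTo⁺ (suc r)) (∈-upTo⁺ (s≤s (≤-trans (m≤m+n t′ _) (m≤m+n (2 * t′) d))))) ⟩
    1 * X
      ≡⟨ cong (λ b → 𝟙 b * X) (sym (dec-true (r ℕ.≟ r) refl)) ⟩
    𝟙 (r ≡ᵇ r) * X ∎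
    where
    open ≡-Reasoning
    X = (q ∸ 1) ^ (t′ + d) * π (q ^ (h + (2 * t′ + d)) , 0)
    single : ∀ t → 𝟙 (does (2 * t ℕ.≤? r)) * ((q ∸ 1) ^ (t + (r ∸ 2 * t)) * value (φ t (r ∸ 2 * t))
        (t′ , d , h)) ≡ 𝟙 (does (t ℕ.≟ t′)) * X
    single t with t ℕ.≟ t′
    ... | yes refl = begin
      𝟙 (does (2 * t ℕ.≤? r)) * ((q ∸ 1) ^ (t + (r ∸ 2 * t)) * value (φ t (r ∸ 2 * t)) (t , d , h))
        ≡⟨ cong₂ (λ b s → 𝟙 b * ((q ∸ 1) ^ (t + s) * value (φ t s) (t , d , h))) (dec-true (2 * t ℕ.≤? r)
            (m≤m+n (2 * t) d)) (m+n∸m≡n (2 * t) d) ⟩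
      1 * ((q ∸ 1) ^ (t + d) * (𝟙 ((2 * t ≡ᵇ 2 * t) ∧ (d ≡ᵇ d)) * π (sqrtPow q (2 * h + t + d + 3 * t + d))))
        ≡⟨ cong₂ (λ b x → 1 * ((q ∸ 1) ^ (t + d) * (𝟙 b * π x))) (cong₂ _∧_ (dec-true
            (2 * t ℕ.≟ 2 * t) refl) (dec-true (d ℕ.≟ d) refl))
             (trans (cong (sqrtPow q) exponent) (sqrtPow-even q (h + (2 * t + d)))) ⟩
      1 * ((q ∸ 1) ^ (t + d) * (1 * π (q ^ (h + (2 * t + d)) , 0)))
        ≡⟨ cong (λ z → 1 * ((q ∸ 1) ^ (t + d) * z)) (*-identityˡ _) ⟩
      1 * X′
        ≡⟨ cong (λ b → 𝟙 b * X′) (sym (dec-true (t ℕ.≟ t) refl)) ⟩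
      𝟙 (does (t ℕ.≟ t)) * X′ ∎
      where
      X′ = (q ∸ 1) ^ (t + d) * π (q ^ (h + (2 * t + d)) , 0)
      -- With `2 h + t + d` attacked cells the exponent of √q is even, and `sqrtPow-even` turns it
      -- into an integral power of `q`.
      exponent : 2 * h + t + d + 3 * t + d ≡ 2 * (h + (2 * t + d))
      exponent = solve 3 (λ h t d → con 2 :* h :+ t :+ d :+ con 3 :* t :+ d := con 2 :* (h :+ (con 2 :* t :+ d))) refl h t d
        where open +-*-Solver
    ... | no t≢t′ = trans
      (cong (λ b → 𝟙 (does (2 * t ℕ.≤? r)) * ((q ∸ 1) ^ (t + (r ∸ 2 * t)) * (𝟙 (b ∧ (d ≡ᵇ r ∸ 2 * t)) * π
          (sqrtPow q (2 * h + t′ + d + 3 * t + (r ∸ 2 * t))))))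
        (dec-false (2 * t′ ℕ.≟ 2 * t) (t≢t′ ∘ sym ∘ *-cancelˡ-≡ t′ t 2)))
      (trans (cong (𝟙 (does (2 * t ℕ.≤? r)) *_) (*-zeroʳ ((q ∸ 1) ^ (t + (r ∸ 2 * t)))))
        (trans (*-zeroʳ (𝟙 (does (2 * t ℕ.≤? r)))) (cong (λ b → 𝟙 b * X) (sym (dec-false (t ℕ.≟ t′) t≢t′)))))

  π-scaledRHS : ∀ {n} (F : Diagram n) → IsFerrers F → IsSymmetricDiagram F → ∀ r →
    π (scaledRHS q F (ℤ.+ r)) ≡ ∑ (types F) (contribution q (λ e → π (q ^ e , 0)) r)
  π-scaledRHS F fer syF r = begin
    π (scaledRHS q F (ℤ.+ r))
      ≡⟨ trans (π-Σ√ _ (pairsFor (ℤ.+ r))) (trans (∑-map (λ t → (t , r ∸ 2 * t)) _ (filter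
          (λ t → 2 * t ℕ.≤? r) (upTo (suc r)))) (∑-filter (λ t → 2 * t ℕ.≤? r) _ (upTo (suc r)))) ⟩
    ∑[ t ∈ upTo (suc r) ] (𝟙 (does (2 * t ℕ.≤? r)) * π (((q ∸ 1) ^ (t + (r ∸ 2 * t))) ⊙ Rsym t))
      ≡⟨ ∑-cong (λ t → cong (𝟙 (does (2 * t ℕ.≤? r)) *_) (trans (π-⊙ ((q ∸ 1) ^ (t + (r ∸ 2 * t))) (Rsym t))
          (cong ((q ∸ 1) ^ (t + (r ∸ 2 * t)) *_)
           (trans (π-Rsym F t (r ∸ 2 * t)) (rookSum-types F fer syF (φ t (r ∸ 2 * t))))))) (upTo (suc r)) ⟩
    ∑[ t ∈ upTo (suc r) ] (𝟙 (does (2 * t ℕ.≤? r)) * ((q ∸ 1) ^ (t + (r ∸ 2 * t)) * ∑ (types F) (value (φ t (r ∸ 2 * t)))))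
      ≡⟨ ∑-cong (λ t → trans (cong (𝟙 (does (2 * t ℕ.≤? r)) *_) (sym (∑-*ˡ ((q ∸ 1) ^ (t + (r ∸ 2 * t)))
          (value (φ t (r ∸ 2 * t))) (types F)))) (sym (∑-*ˡ (𝟙 (does (2 * t ℕ.≤? r))) _ (types F)))) (upTo (suc r)) ⟩
    ∑[ t ∈ upTo (suc r) ] (∑[ τ ∈ types F ] (𝟙 (does (2 * t ℕ.≤? r)) * ((q ∸ 1) ^ (t + (r ∸ 2 * t)) * value (φ t (r ∸ 2 * t)) τ)))
      ≡⟨ ∑-swap _ (upTo (suc r)) (types F) ⟩
    ∑[ τ ∈ types F ] (∑[ t ∈ upTo (suc r) ] (𝟙 (does (2 * t ℕ.≤? r)) * ((q ∸ 1) ^ (t + (r ∸ 2 * t)) * value (φ t (r ∸ 2 * t)) τ)))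
      ≡⟨ ∑-cong (∑-pairs-of-type r) (types F) ⟩
    ∑ (types F) (contribution q (λ e → π (q ^ e , 0)) r) ∎
    where
    open ≡-Reasoning
    Rsym : ℕ → ℕ√
    Rsym t = Σ√ (map (λ e → sqrtPow q ((size F ∸ e) + 3 * t + (r ∸ 2 * t))) (RsymExps F t (r ∸ 2 * t)))

module _ (K : FiniteField) where
  open SymmetricMatrices K
  open LinearAlgebra K using (q; q≢0)

  -- `W` is the case where `ψ` is the indicator of rank `r`. The scaling `q ^ r` joins `q ^ h`,
  -- which accounts for the exponent in `contribution`.
  scaledW : ∀ {n} (F : Diagram n) → IsFerrers F → IsSymmetricDiagram F → ∀ r →
    q ^ r * W K F (ℤ.+ r) ≡ ∑ (types F) (contribution q (q ^_) r)
  scaledW {n} F fer syF r = begin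
    q ^ r * W K F (ℤ.+ r)
      ≡⟨ cong (q ^ r *_) (trans (count≡∑ _ (allMatrices K n)) (∑-cong split (allMatrices K n))) ⟩
    q ^ r * rankSum F (λ k → 𝟙 (k ≡ᵇ r))
      ≡⟨ cong (q ^ r *_) (rankSum-types F fer syF (λ k → 𝟙 (k ≡ᵇ r))) ⟩
    q ^ r * ∑ (types F) (weight q (λ k → 𝟙 (k ≡ᵇ r)))
      ≡⟨ sym (∑-*ˡ (q ^ r) _ (types F)) ⟩
    ∑[ τ ∈ types F ] (q ^ r * weight q (λ k → 𝟙 (k ≡ᵇ r)) τ)
      ≡⟨ ∑-cong term (types F) ⟩
    ∑ (types F) (contribution q (q ^_) r) ∎
    where
    open ≡-Reasoning
    split : ∀ M → 𝟙 (isSymmetricMatrix K M ∧ supportIn K F M ∧ (rank K M ≡ᵇ r)) ≡ 𝟙 (admissible F M) * 𝟙 (rank K M ≡ᵇ r)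
    split M = trans (cong 𝟙 (sym (Bool.∧-assoc (isSymmetricMatrix K M) (supportIn K F M) _))) (𝟙-∧ (admissible F M) _)
    term : ∀ τ → q ^ r * weight q (λ k → 𝟙 (k ≡ᵇ r)) τ ≡ contribution q (q ^_) r τ
    term (t , d , h) with (2 * t + d) ≡ᵇ r in eq
    ... | false = trans (cong (q ^ r *_) (*-zeroʳ ((q ∸ 1) ^ (t + d) * q ^ h))) (*-zeroʳ (q ^ r))
    ... | true  with does≡true ((2 * t + d) ℕ.≟ r) eq
    ...   | refl = trans (solve 3 (λ a b c → c :* (a :* b :* con 1) := con 1 :* (a :* (b :* c))) refl
        ((q ∸ 1) ^ (t + d)) (q ^ h) (q ^ r))
        (cong (λ z → 1 * ((q ∸ 1) ^ (t + d) * z)) (sym (^-distribˡ-+-* q h r)))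
      where open +-*-Solver

contribution-zero : ∀ q r τ → contribution q (λ _ → 0) r τ ≡ 0
contribution-zero q r (t , d , h) = trans (cong (𝟙 ((2 * t + d) ≡ᵇ r) *_) (*-zeroʳ ((q ∸ 1) ^ (t + d))))
    (*-zeroʳ (𝟙 ((2 * t + d) ≡ᵇ r)))

-- Without a √q part both sides of the squared equation are 0.
≈√-exact : ∀ q {w a b} → w ≡ a → b ≡ 0 → w ≈√[ q ] (a , b)
≈√-exact q {w} refl refl = ≤-refl , trans (cong (λ z → z * z) (n∸n≡0 w)) (sym (*-zeroʳ q))

theorem4p7 : (q : ℕ) → IsPrimePower q → (K : FiniteField) → FiniteField.order K ≡ q →
    (n : ℕ) → 1 ≤ n → (F : Diagram n) → IsFerrers F → IsSymmetricDiagram F →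
    (r : ℤ) →
    (q ^ ∣ r ∣ * W K F r) ≈√[ q ] scaledRHS q F r
theorem4p7 q _ K refl n _ F fer syF (ℤ.+ r) = ≈√-exact (FiniteField.order K)
  (trans (scaledW K F fer syF r) (sym (π-scaledRHS q proj₁ refl (λ _ _ → refl) (λ _ _ → refl) F fer syF r)))
  -- The √q component: every type contributes the second component of an integral power of `q`,
  -- which is 0.
  (trans (π-scaledRHS q proj₂ refl (λ _ _ → refl) (λ _ _ → refl) F fer syF r)
    (trans (∑-cong (contribution-zero q r) (types F)) (∑-zero (types F))))
-- For negative rank `W` is 0 by definition and there are no pairs to sum over.
theorem4p7 q _ K refl n _ F fer syF ℤ.-[1+ r ] = ≈√-exact (FiniteField.order K) (*-zeroʳ (q ^ suc r)) refl
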